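{- Given oracle access to an $\alpha$-approximation algorithm for the Free-Order Prophets problem, there exists a polynomial time $\alpha$-approximation algorithm for the Pandora's Box with Commitment problem.
   Context: Free-Order Prophets: given independent random variables $X_1,\dots,X_n$, choose a permutation $\sigma\in S_n$ in which outcomes are observed and a stopping rule, receiving the observed value at stopping; for fixed $\sigma$, $V(\sigma)=R_1$ with $R_{n+1}=0$, $R_t=\mathbb{E}[\max\{X_{\sigma(t)},R_{t+1}\}]$; an $\alpha$-approximation returns $\sigma$ with $V(\sigma)\ge\alpha\cdot\max_{\sigma'}V(\sigma')$. Pandora's Box with Commitment: given independent random variables $X_1,\dots,X_n$ and probing costs $c_1,\dots,c_n\in\mathbb{R}_+$, a policy chooses an order $\sigma$ (possibly adaptively) and a stopping time $\tau$, must select the last observed variable, and obtains $X_{\sigma(\tau)}-\sum_{t\le\tau}c_{\sigma(t)}$; the goal is to maximize the expectation of this quantity, and an $\alpha$-approximation achieves at least $\alpha$ times the optimal expected utility.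
   Formalization: Proved for inputs given explicitly: each random variable is non-negative with finitely many rational values and rational probabilities, and the probing costs are rational rather than real; probing no box is allowed and worth 0. -}

module Defs where

open import Data.Fin.Base using (Fin; toℕ; fromℕ<)
open import Data.Fin.Permutation using (Permutation′; _⟨$⟩ʳ_)
open import Data.Fin.Subset using (Subset; ⊤; _∈_; _-_)
open import Data.Fin.Subset.Properties using (_∈?_)
import Data.Integer.Base as ℤ
open import Data.List.Base as List using (List; []; _∷_)
import Data.List.Membership.Propositional as ListMembership
open import Data.List.Relation.Unary.All as All using (All; []; _∷_)
open import Data.Nat.Base as ℕ using (ℕ; zero; suc)
import Data.Nat.Properties as ℕ
open import Data.Nat.Logarithm using (⌊log₂_⌋)
open import Data.Product.Base using (Σ; ∃-syntax; _×_; _,_; proj₁; proj₂)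
open import Data.Rational.Unnormalised.Base as ℚ
  using (ℚᵘ; 0ℚᵘ; 1ℚᵘ; _≃_; _⊔_; ↥_; ↧ₙ_)
open import Data.Vec.Base as Vec using (Vec; []; _∷_; lookup)
open import Relation.Binary.PropositionalEquality using (_≡_)
open import Relation.Nullary.Decidable using (yes; no)

------------------------------------------------------------------------
-- Random variables

-- Numbers are written fractions (ℚᵘ), so that an instance is a finite
-- object with a bit length.

expect : List (ℚᵘ × ℚᵘ) → (ℚᵘ → ℚᵘ) → ℚᵘ
expect vps f = List.foldr (λ (v , p) s → p ℚ.* f v ℚ.+ s) 0ℚᵘ vps

-- The law of a non-negative, finitely supported random variable, as a
-- list of (value, probability) pairs; a value may be listed repeatedly.
record RV : Set where
  field
    law        : List (ℚᵘ × ℚᵘ)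
    values≥0   : All (λ (v , _) → 0ℚᵘ ℚ.≤ v) law
    probs≥0    : All (λ (_ , p) → 0ℚᵘ ℚ.≤ p) law
    total-mass : expect law (λ _ → 1ℚᵘ) ≃ 1ℚᵘ

open RV public

𝔼 : RV → (ℚᵘ → ℚᵘ) → ℚᵘ
𝔼 X = expect (law X)

-- Expectation over the joint law of independent X₁, …, Xₙ, i.e. with
-- respect to the product measure.
𝔼-joint : ∀ {n} → Vec RV n → (Vec ℚᵘ n → ℚᵘ) → ℚᵘ
𝔼-joint []       f = f []
𝔼-joint (X ∷ Xs) f = 𝔼 X (λ x → 𝔼-joint Xs (λ xs → f (x ∷ xs)))

------------------------------------------------------------------------
-- Free-Order Prophets

-- R_{n+1} = 0 and R_t = 𝔼[max{X_t , R_{t+1}}], for variables listed in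
-- the order of observation.
R : List RV → ℚᵘ
R []       = 0ℚᵘ
R (X ∷ Xs) = 𝔼 X (λ x → x ⊔ R Xs)

V : ∀ {n} → Vec RV n → Permutation′ n → ℚᵘ
V Xs σ = R (List.tabulate (λ t → lookup Xs (σ ⟨$⟩ʳ t)))

-- V(σ) ≥ α · max_{σ′} V(σ′), for α ≥ 0.
_ApproximatesProphets_On_ : ∀ {n} → Permutation′ n → ℚᵘ → Vec RV n → Set
σ ApproximatesProphets α On Xs = ∀ σ′ → α ℚ.* V Xs σ′ ℚ.≤ V Xs σ

------------------------------------------------------------------------
-- Pandora's Box with Commitment

record Box : Set where
  field
    content : RV
    cost    : ℚᵘ
    cost≥0  : 0ℚᵘ ℚ.≤ cost

open Box public

-- An adaptive policy, S being the set of boxes not yet probed.  Stopping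
-- selects the last observed variable; the box probed next may depend on
-- everything observed so far.
data Policy {n : ℕ} (S : Subset n) : Set where
  stop  : Policy S
  probe : (i : Fin n) → i ∈ S → (ℚᵘ → Policy (S - i)) → Policy S

-- X_{σ(τ)} − Σ_{t ≤ τ} c_{σ(t)} on the realisation xs, where `last` is the
-- variable observed last before the policy is resumed.
utilityFrom : ∀ {n} {S : Subset n} →
              ℚᵘ → Vec Box n → Vec ℚᵘ n → Policy S → ℚᵘ
utilityFrom last bs xs stop          = last
utilityFrom last bs xs (probe i _ π) =
  utilityFrom (lookup xs i) bs xs (π (lookup xs i)) ℚ.- cost (lookup bs i)

-- Probing no box at all (τ = 0) is worth 0.
utility : ∀ {n} → Vec Box n → Vec ℚᵘ n → Policy {n} ⊤ → ℚᵘ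
utility = utilityFrom 0ℚᵘ

expectedUtility : ∀ {n} → Vec Box n → Policy {n} ⊤ → ℚᵘ
expectedUtility bs π =
  𝔼-joint (Vec.map content bs) (λ xs → utility bs xs π)

_ApproximatesPandora_On_ : ∀ {n} → Policy {n} ⊤ → ℚᵘ → Vec Box n → Set
π ApproximatesPandora α On bs =
  ∀ π′ → α ℚ.* expectedUtility bs π′ ℚ.≤ expectedUtility bs π

-- The probes made so far with their outcomes, most recent first.
History : ℕ → Set
History n = List (Fin n × ℚᵘ)

-- The policy that consults a decision rule after every observation: the
-- answer k means "probe box k" if k is the index of an unprobed box, and
-- "stop" otherwise.  The first argument bounds the number of probes.
follow : ∀ {n} → ℕ → (History n → ℕ) → (S : Subset n) → History n → Policy S
follow         zero    rule S h = stop
follow {n = n} (suc m) rule S h with rule h ℕ.<? n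
... | no  _   = stop
... | yes k<n with fromℕ< k<n ∈? S
...   | no  _   = stop
...   | yes i∈S = probe (fromℕ< k<n) i∈S
                    (λ x → follow m rule (S - fromℕ< k<n)
                                  ((fromℕ< k<n , x) ∷ h))

policyOf : ∀ {n} → (History n → ℕ) → Policy {n} ⊤
policyOf {n} rule = follow n rule ⊤ []

------------------------------------------------------------------------
-- Oracle programs and their running time

-- A first-order language on natural numbers, pairs and lists, with
-- iteration along lists and calls to an oracle of type Q → A.

infixr 7 _⊗_

data Ty : Set where
  nat  : Ty
  _⊗_  : Ty → Ty → Ty
  list : Ty → Ty

⟦_⟧ᵗ : Ty → Set
⟦ nat ⟧ᵗ    = ℕ
⟦ a ⊗ b ⟧ᵗ  = ⟦ a ⟧ᵗ × ⟦ b ⟧ᵗ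
⟦ list a ⟧ᵗ = List ⟦ a ⟧ᵗ

-- Bit length, up to a constant factor; naturals are written in binary.
size : ∀ a → ⟦ a ⟧ᵗ → ℕ
size nat      k       = suc ⌊log₂ k ⌋
size (a ⊗ b)  (x , y) = suc (size a x ℕ.+ size b y)
size (list a) xs      = List.foldr (λ x s → suc (size a x ℕ.+ s)) 1 xs

Ctx : Set
Ctx = List Ty

data Term (Q A : Ty) (Γ : Ctx) : Ty → Set where
  var      : ∀ {a} → a ListMembership.∈ Γ → Term Q A Γ a
  letin    : ∀ {a b} → Term Q A Γ a → Term Q A (a ∷ Γ) b → Term Q A Γ b
  lit      : ℕ → Term Q A Γ nat
  add      : Term Q A Γ nat → Term Q A Γ nat → Term Q A Γ nat
  monus    : Term Q A Γ nat → Term Q A Γ nat → Term Q A Γ nat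
  mul      : Term Q A Γ nat → Term Q A Γ nat → Term Q A Γ nat
  if_≤_then_else_ :
    ∀ {a} → Term Q A Γ nat → Term Q A Γ nat →
    Term Q A Γ a → Term Q A Γ a → Term Q A Γ a
  pair     : ∀ {a b} → Term Q A Γ a → Term Q A Γ b → Term Q A Γ (a ⊗ b)
  fst      : ∀ {a b} → Term Q A Γ (a ⊗ b) → Term Q A Γ a
  snd      : ∀ {a b} → Term Q A Γ (a ⊗ b) → Term Q A Γ b
  nil      : ∀ {a} → Term Q A Γ (list a)
  cons     : ∀ {a} → Term Q A Γ a → Term Q A Γ (list a) → Term Q A Γ (list a)
  caseList : ∀ {a b} → Term Q A Γ (list a) →
             Term Q A Γ b → Term Q A (a ∷ list a ∷ Γ) b → Term Q A Γ b
  fold     : ∀ {a b} → Term Q A Γ (list a) →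
             Term Q A Γ b → Term Q A (a ∷ b ∷ Γ) b → Term Q A Γ b
  ask      : Term Q A Γ Q → Term Q A Γ A

Env : Ctx → Set
Env = All ⟦_⟧ᵗ

module Semantics {Q A : Ty} (O : ⟦ Q ⟧ᵗ → ⟦ A ⟧ᵗ) where

  branch : {B : Set} → ℕ → ℕ → B → B → B
  branch m n x y with m ℕ.≤? n
  ... | yes _ = x
  ... | no  _ = y

  value : ∀ {Γ a} → Term Q A Γ a → Env Γ → ⟦ a ⟧ᵗ
  value (var x)                    ρ = All.lookup ρ x
  value (letin s t)                ρ = value t (value s ρ ∷ ρ)
  value (lit k)                    ρ = k
  value (add s t)                  ρ = value s ρ ℕ.+ value t ρ
  value (monus s t)                ρ = value s ρ ℕ.∸ value t ρ
  value (mul s t)                  ρ = value s ρ ℕ.* value t ρ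
  value (if s ≤ t then u else v)   ρ =
    branch (value s ρ) (value t ρ) (value u ρ) (value v ρ)
  value (pair s t)                 ρ = value s ρ , value t ρ
  value (fst t)                    ρ = proj₁ (value t ρ)
  value (snd t)                    ρ = proj₂ (value t ρ)
  value nil                        ρ = []
  value (cons s t)                 ρ = value s ρ ∷ value t ρ
  value (caseList s t u)           ρ with value s ρ
  ... | []     = value t ρ
  ... | x ∷ xs = value u (x ∷ xs ∷ ρ)
  value (fold s t u)               ρ =
    List.foldr (λ x y → value u (x ∷ y ∷ ρ)) (value t ρ) (value s ρ)
  value (ask t)                    ρ = O (value t ρ)

  foldTime : {B C : Set} → (B → C → C) → (B → C → ℕ) → C → List B → ℕ
  foldTime f time z []       = 0
  foldTime f time z (x ∷ xs) =
    foldTime f time z xs ℕ.+ time x (List.foldr f z xs)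

  -- Every evaluation step is charged the bit length of the value it
  -- produces, its operands having been charged when they were evaluated.
  -- A Turing machine carries out each step, copying included, in time
  -- polynomial in the operands and the result, so a polynomial bound on
  -- `time` is a polynomial bound on Turing-machine time.  An oracle call
  -- costs the length of the query plus the length of the answer.
  mutual
    time : ∀ {Γ a} → Term Q A Γ a → Env Γ → ℕ
    time {a = a} t ρ = size a (value t ρ) ℕ.+ subtime t ρ

    subtime : ∀ {Γ a} → Term Q A Γ a → Env Γ → ℕ
    subtime (var x)                  ρ = 0
    subtime (letin s t)              ρ = time s ρ ℕ.+ time t (value s ρ ∷ ρ)
    subtime (lit k)                  ρ = 0
    subtime (add s t)                ρ = time s ρ ℕ.+ time t ρ
    subtime (monus s t)              ρ = time s ρ ℕ.+ time t ρ
    subtime (mul s t)                ρ = time s ρ ℕ.+ time t ρ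
    subtime (if s ≤ t then u else v) ρ =
      time s ρ ℕ.+ time t ρ ℕ.+
      branch (value s ρ) (value t ρ) (time u ρ) (time v ρ)
    subtime (pair s t)               ρ = time s ρ ℕ.+ time t ρ
    subtime (fst t)                  ρ = time t ρ
    subtime (snd t)                  ρ = time t ρ
    subtime nil                      ρ = 0
    subtime (cons s t)               ρ = time s ρ ℕ.+ time t ρ
    subtime (caseList s t u)         ρ with value s ρ
    ... | []     = time s ρ ℕ.+ time t ρ
    ... | x ∷ xs = time s ρ ℕ.+ time u (x ∷ xs ∷ ρ)
    subtime (fold s t u)             ρ =
      time s ρ ℕ.+ time t ρ ℕ.+
      foldTime (λ x y → value u (x ∷ y ∷ ρ)) (λ x y → time u (x ∷ y ∷ ρ))
               (value t ρ) (value s ρ)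
    subtime (ask t)                  ρ = time t ρ

------------------------------------------------------------------------
-- Encodings of instances

fracᵗ lawᵗ prophetsᵗ orderᵗ pandoraᵗ historyᵗ : Ty
fracᵗ     = nat ⊗ nat
lawᵗ      = list (fracᵗ ⊗ fracᵗ)
prophetsᵗ = list lawᵗ
orderᵗ    = list nat
pandoraᵗ  = list (lawᵗ ⊗ fracᵗ)
historyᵗ  = list (nat ⊗ fracᵗ)

-- Numerator and denominator; all the numbers in instances are ≥ 0.
encFrac : ℚᵘ → ⟦ fracᵗ ⟧ᵗ
encFrac q = ℤ.∣ ↥ q ∣ , ↧ₙ q

encLaw : RV → ⟦ lawᵗ ⟧ᵗ
encLaw X = List.map (λ (v , p) → encFrac v , encFrac p) (law X)

encProphets : ∀ {n} → Vec RV n → ⟦ prophetsᵗ ⟧ᵗ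
encProphets Xs = List.map encLaw (Vec.toList Xs)

encOrder : ∀ {n} → Permutation′ n → ⟦ orderᵗ ⟧ᵗ
encOrder σ = List.tabulate (λ t → toℕ (σ ⟨$⟩ʳ t))

encPandora : ∀ {n} → Vec Box n → ⟦ pandoraᵗ ⟧ᵗ
encPandora bs =
  List.map (λ b → encLaw (content b) , encFrac (cost b)) (Vec.toList bs)

encHistory : ∀ {n} → History n → ⟦ historyᵗ ⟧ᵗ
encHistory = List.map (λ (i , x) → toℕ i , encFrac x)

------------------------------------------------------------------------
-- Algorithms

ProphetsOracle : Set
ProphetsOracle = ⟦ prophetsᵗ ⟧ᵗ → ⟦ orderᵗ ⟧ᵗ

-- Nothing is assumed of the answers to queries that encode no instance.
IsProphetsApproximation : ℚᵘ → ProphetsOracle → Set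
IsProphetsApproximation α O =
  ∀ {n} (Xs : Vec RV n) →
  ∃[ σ ] O (encProphets Xs) ≡ encOrder {n} σ × σ ApproximatesProphets α On Xs

-- A program for Pandora's Box with Commitment chooses the next action
-- from the instance and the history.
PandoraProgram : Set
PandoraProgram = Term prophetsᵗ orderᵗ (pandoraᵗ ∷ historyᵗ ∷ []) nat

decide : ProphetsOracle → PandoraProgram →
         ∀ {n} → Vec Box n → History n → ℕ
decide O P bs h = value P (encPandora bs ∷ encHistory h ∷ [])
  where open Semantics O

IsPandoraApproximation : ℚᵘ → ProphetsOracle → PandoraProgram → Set
IsPandoraApproximation α O P =
  ∀ {n} (bs : Vec Box n) →
  policyOf (decide O P bs) ApproximatesPandora α On bs

-- Every decision takes time at most c · ℓᵈ, ℓ being the input length.  A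
-- run makes at most n + 1 decisions, and the outcomes in its history are
-- values listed in the instance, so this bounds whole runs as well.
RunsInTime : (c d : ℕ) → ProphetsOracle → PandoraProgram → Set
RunsInTime c d O P =
  ∀ {n} (bs : Vec Box n) (h : History n) →
  time P (encPandora bs ∷ encHistory h ∷ [])
    ℕ.≤ c ℕ.* (size pandoraᵗ (encPandora bs) ℕ.+
               size historyᵗ (encHistory h)) ℕ.^ d
  where open Semantics O

{-# OPTIONS --safe #-}
module Submission where

-- Let s be the reservation value of a box (X, c), so 𝔼[(X − s)⁺] = c, and
-- put Y = min(X, s⁺).  Then 𝔼[max(Y, r)] = max(r, 𝔼[max(X, r)] − c) for all
-- r ≥ 0: a prophet observing Y gains exactly what is gained by opening the
-- box, or skipping it, at continuation value r.  Hence V(σ) for the capped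
-- variables Y is attained by the policy that follows σ, skips the boxes not
-- worth opening and stops once the observation is at least R_{t+1};
-- conversely, by induction on the policy tree, no adaptive policy exceeds
-- max_σ V(σ).  An α-approximate order for the Y's therefore yields an
-- α-approximate policy.
--
-- All numbers stay short because each fold multiplies the bound
-- 1 + numerator + denominator by a factor read off the input only.

open import Defs
open import Data.Fin.Base as Fin using (Fin; zero; suc; toℕ; fromℕ<)
open import Data.List.Base as List using (List; []; _∷_; _++_; map; foldr; length; drop)
open import Data.List.Relation.Unary.All as All using (All; []; _∷_)
open import Data.List.Relation.Unary.Any as Any using (here; there)
open import Data.Nat.Base as ℕ using (ℕ; zero; suc)
import Data.Nat.Properties as ℕ
open import Data.Product.Base using (∃-syntax; _×_; _,_; proj₁; proj₂)
open import Data.Sum.Base using (_⊎_; inj₁; inj₂)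
open import Data.Vec.Base as Vec using (Vec; []; _∷_; lookup; _[_]≔_)
open import Relation.Binary.PropositionalEquality
  using (_≡_; _≢_; refl; sym; trans; cong; cong₂; subst; subst₂; module ≡-Reasoning)
open import Relation.Nullary using (yes; no; contradiction)

-- The program, the constant and the exponent are fixed before α and the oracle. Every time bound is
-- therefore a syntactic polynomial valid for all oracles at once. The only thing an oracle controls
-- is the length of its answer: nothing is known about queries that encode no instance, but the
-- query made is literally the encoding of the capped boxes, so the answer lists a permutation.
--
-- Decisions share no memory. The order is requested anew each time, and the oracle, being a
-- function, always returns the same one; of the history, the program reads only the latest
-- observation.
--
-- Reservation values come from no equation solver: 𝔼[(X - s)⁺] is piecewise linear in s with breaks
-- at the values of X, so s is the largest of finitely many quotients, one for each value. If the
-- cost exceeds 𝔼[X], the solution is negative and truncated subtraction yields 0 instead. This is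
-- harmless: continuation values are never negative, and a variable capped at 0 raises none of them.

module PolynomialTime where

  open import Data.Empty using () renaming (⊥ to 𝟘)
  open import Data.List.Membership.Propositional using (_∈_)
  open import Data.Nat.Base using (_+_; _*_; _^_; _≤_; _<_; z≤n; s≤s)
  open import Data.Nat.Logarithm
  open import Data.Nat.Properties hiding (_≟_; _≤?_; _<?_)
  open import Data.Nat.Solver using (module +-*-Solver)
  open import Data.Unit.Base using () renaming (⊤ to 𝟙)

  -- Polynomial bounds and bit lengths

  data Poly : Set where
    con         : ℕ → Poly
    X           : Poly
    _⊞_ _⊠_ _⊙_ : Poly → Poly → Poly

  infixl 6 _⊞_
  infixl 7 _⊠_
  infixl 8 _⊙_

  eval : Poly → ℕ → ℕ
  eval (con k) n = k
  eval X       n = n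
  eval (p ⊞ q) n = eval p n + eval q n
  eval (p ⊠ q) n = eval p n * eval q n
  eval (p ⊙ q) n = eval p (eval q n)

  eval-mono : ∀ p {m n} → m ≤ n → eval p m ≤ eval p n
  eval-mono (con k) m≤n = ≤-refl
  eval-mono X       m≤n = m≤n
  eval-mono (p ⊞ q) m≤n = +-mono-≤ (eval-mono p m≤n) (eval-mono q m≤n)
  eval-mono (p ⊠ q) m≤n = *-mono-≤ (eval-mono p m≤n) (eval-mono q m≤n)
  eval-mono (p ⊙ q) m≤n = eval-mono p (eval-mono q m≤n)

  ^-distribʳ-* : ∀ d m n → (m * n) ^ d ≡ m ^ d * n ^ d
  ^-distribʳ-* zero    m n = refl
  ^-distribʳ-* (suc d) m n = trans (cong (m * n *_) (^-distribʳ-* d m n))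
                                   ([m*n]*[o*p]≡[m*o]*[n*p] m n (m ^ d) (n ^ d))

  -- The base `suc n` is at least 1, so exponents may be raised to a common `d + d′`. In a
  -- composition the extra 1 is absorbed by 1 ≤ `suc n ^ d′`, which turns `c′` into `suc c′`.
  eval≤monomial : ∀ p → ∃[ c ] ∃[ d ] (∀ n → eval p n ≤ c * suc n ^ d)
  eval≤monomial (con k) = k , 0 , λ n → ≤-reflexive (sym (*-identityʳ k))
  eval≤monomial X       = 1 , 1 , λ n →
    ≤-trans (n≤1+n n) (≤-reflexive (sym (trans (*-identityˡ _) (^-identityʳ (suc n)))))
  eval≤monomial (p ⊞ q) with eval≤monomial p | eval≤monomial q
  ... | c , d , p≤ | c′ , d′ , q≤ = c + c′ , d + d′ , λ n → begin
    eval p n + eval q n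
      ≤⟨ +-mono-≤ (p≤ n) (q≤ n) ⟩
    c * suc n ^ d + c′ * suc n ^ d′
      ≤⟨ +-mono-≤ (*-monoʳ-≤ c (^-monoʳ-≤ (suc n) (m≤m+n d d′)))
                  (*-monoʳ-≤ c′ (^-monoʳ-≤ (suc n) (m≤n+m d′ d))) ⟩
    c * suc n ^ (d + d′) + c′ * suc n ^ (d + d′)
      ≡⟨ *-distribʳ-+ (suc n ^ (d + d′)) c c′ ⟨
    (c + c′) * suc n ^ (d + d′) ∎
    where open ≤-Reasoning
  eval≤monomial (p ⊠ q) with eval≤monomial p | eval≤monomial q
  ... | c , d , p≤ | c′ , d′ , q≤ = c * c′ , d + d′ , λ n → begin
    eval p n * eval q n
      ≤⟨ *-mono-≤ (p≤ n) (q≤ n) ⟩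
    (c * suc n ^ d) * (c′ * suc n ^ d′)
      ≡⟨ [m*n]*[o*p]≡[m*o]*[n*p] c (suc n ^ d) c′ (suc n ^ d′) ⟩
    (c * c′) * (suc n ^ d * suc n ^ d′)
      ≡⟨ cong (c * c′ *_) (^-distribˡ-+-* (suc n) d d′) ⟨
    (c * c′) * suc n ^ (d + d′) ∎
    where open ≤-Reasoning
  eval≤monomial (p ⊙ q) with eval≤monomial p | eval≤monomial q
  ... | c , d , p≤ | c′ , d′ , q≤ = c * suc c′ ^ d , d′ * d , λ n → begin
    eval p (eval q n)
      ≤⟨ p≤ (eval q n) ⟩
    c * suc (eval q n) ^ d
      ≤⟨ *-monoʳ-≤ c (^-monoˡ-≤ d (+-mono-≤ (m^n>0 (suc n) d′) (q≤ n))) ⟩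
    c * (suc c′ * suc n ^ d′) ^ d
      ≡⟨ cong (c *_) (^-distribʳ-* d (suc c′) (suc n ^ d′)) ⟩
    c * (suc c′ ^ d * (suc n ^ d′) ^ d)
      ≡⟨ *-assoc c (suc c′ ^ d) _ ⟨
    c * suc c′ ^ d * (suc n ^ d′) ^ d
      ≡⟨ cong (c * suc c′ ^ d *_) (^-*-assoc (suc n) d′ d) ⟩
    c * suc c′ ^ d * suc n ^ (d′ * d) ∎
    where open ≤-Reasoning

  n<2^size : ∀ n → n < 2 ^ size nat n
  n<2^size n with suc n ℕ.≤? 2 ^ size nat n
  ... | yes n< = n<
  ... | no ¬n< = contradiction
    (≤-trans (≤-reflexive (sym (⌊log₂[2^n]⌋≡n (size nat n))))
             (⌊log₂⌋-mono-≤ (≮⇒≥ ¬n<)))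
    (<⇒≱ (n<1+n ⌊log₂ n ⌋))

  size≤ : ∀ {n k} → n < 2 ^ k → size nat n ≤ suc k
  size≤ {k = k} n<2^k =
    s≤s (≤-trans (⌊log₂⌋-mono-≤ (<⇒≤ n<2^k)) (≤-reflexive (⌊log₂[2^n]⌋≡n k)))

  size-mono : ∀ {m n} → m ≤ n → size nat m ≤ size nat n
  size-mono m≤n = s≤s (⌊log₂⌋-mono-≤ m≤n)

  1≤size : ∀ a x → 1 ≤ size a x
  1≤size nat      x        = s≤s z≤n
  1≤size (a ⊗ b)  x        = s≤s z≤n
  1≤size (list a) []       = s≤s z≤n
  1≤size (list a) (x ∷ xs) = s≤s z≤n

  length≤size : ∀ a xs → length xs ≤ size (list a) xs
  length≤size a []       = z≤n
  length≤size a (x ∷ xs) = s≤s (≤-trans (length≤size a xs) (m≤n+m _ (size a x)))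

  -- Both m + n and m · n lie below (1 + m)(1 + n), so one estimate serves addition and
  -- multiplication.
  size-+* : ∀ {k} m n → k < suc m * suc n →
            size nat k ≤ suc (size nat m + size nat n)
  size-+* m n k< = size≤ (<-≤-trans k< (≤-trans
    (*-mono-≤ (n<2^size m) (n<2^size n))
    (≤-reflexive (sym (^-distribˡ-+-* 2 (size nat m) (size nat n))))))

  size-+ : ∀ m n → size nat (m + n) ≤ suc (size nat m + size nat n)
  size-+ m n = size-+* m n (s≤s (≤-trans (m≤m+n (m + n) (m * n)) (≤-reflexive lemma)))
    where
    lemma : m + n + m * n ≡ n + m * suc n
    lemma = solve 2 (λ m n → m :+ n :+ m :* n := n :+ m :* (con 1 :+ n)) refl m n
      where open +-*-Solver

  size-* : ∀ m n → size nat (m * n) ≤ suc (size nat m + size nat n)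
  size-* m n = size-+* m n (s≤s (≤-trans (*-monoʳ-≤ m (n≤1+n n)) (m≤n+m (m * suc n) n)))

  ∥_∥ : ∀ {Γ} → Env Γ → ℕ
  ∥ [] ∥              = 0
  ∥ _∷_ {x = a} v ρ ∥ = size a v + ∥ ρ ∥

  size-lookup : ∀ {Γ a} (ρ : Env Γ) (x : a ∈ Γ) →
                size a (All.lookup ρ x) ≤ ∥ ρ ∥
  size-lookup (v ∷ ρ) (here refl) = m≤m+n _ ∥ ρ ∥
  size-lookup (_∷_ {x = a} v ρ) (there x) =
    ≤-trans (size-lookup ρ x) (m≤n+m ∥ ρ ∥ (size a v))

  -- Polynomial running time by induction on terms

  module _ {Q A : Ty} where

    private
      Oracle : Set
      Oracle = ⟦ Q ⟧ᵗ → ⟦ A ⟧ᵗ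

    open Semantics {Q} {A}

    branch-elim : ∀ {B : Set} O (P : B → Set) m n {x y} →
                  (m ≤ n → P x) → (n < m → P y) → P (branch O m n x y)
    branch-elim O P m n px py with m ℕ.≤? n
    ... | yes m≤n = px m≤n
    ... | no  m≰n = py (≰⇒> m≰n)

    -- The polynomial is chosen before the oracle; this order of quantifiers is what the theorem
    -- asks of its constants.
    PolyTime : ∀ {Γ a} → Term Q A Γ a → Set
    PolyTime t = ∃[ p ] (∀ O ρ → time O t ρ ≤ eval p ∥ ρ ∥)

    -- Since `xs` is arbitrary, the bound also holds on every suffix of the folded list, that is,
    -- for all intermediate accumulators.
    FoldBounded : ∀ {Γ a b} → Term Q A Γ b → Term Q A (a ∷ b ∷ Γ) b → Set
    FoldBounded {Γ} {a} {b} t u = ∃[ p ] (∀ (O : Oracle) (ρ : Env Γ) xs →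
      size b (foldr (λ x y → value O u (x ∷ y ∷ ρ)) (value O t ρ) xs)
        ≤ eval p (size (list a) xs + ∥ ρ ∥))

    -- Iteration is the only construct that may leave polynomial time, when
    -- the accumulator grows too fast.
    Tractable : ∀ {Γ a} → Term Q A Γ a → Set
    Tractable (var x)                = 𝟙
    Tractable (letin s t)            = Tractable s × Tractable t
    Tractable (lit k)                = 𝟙
    Tractable (add s t)              = Tractable s × Tractable t
    Tractable (monus s t)            = Tractable s × Tractable t
    Tractable (mul s t)              = Tractable s × Tractable t
    Tractable (if s ≤ t then u else v) =
      Tractable s × Tractable t × Tractable u × Tractable v
    Tractable (pair s t)             = Tractable s × Tractable t
    Tractable (fst t)                = Tractable t
    Tractable (snd t)                = Tractable t
    Tractable nil                    = 𝟙
    Tractable (cons s t)             = Tractable s × Tractable t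
    Tractable (caseList s t u)       = Tractable s × Tractable t × Tractable u
    Tractable (fold s t u)           =
      Tractable s × Tractable t × Tractable u × FoldBounded t u
    Tractable (ask t)                = 𝟘

    size≤time : ∀ {Γ a} O (t : Term Q A Γ a) ρ → size a (value O t ρ) ≤ time O t ρ
    size≤time O t ρ = m≤m+n _ (subtime O t ρ)

    private
      op-time : ∀ {Γ a b} (s : Term Q A Γ a) (t : Term Q A Γ b) →
                PolyTime s → PolyTime t →
                ∃[ p ] (∀ O ρ {k} → k ≤ suc (size a (value O s ρ) + size b (value O t ρ)) →
                        k + (time O s ρ + time O t ρ) ≤ eval p ∥ ρ ∥)
      op-time s t (p , s≤) (q , t≤) =
        con 1 ⊞ (p ⊞ q) ⊞ (p ⊞ q) , λ O ρ k≤ → +-mono-≤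
          (≤-trans k≤ (s≤s (+-mono-≤ (≤-trans (size≤time O s ρ) (s≤ O ρ))
                                     (≤-trans (size≤time O t ρ) (t≤ O ρ)))))
          (+-mono-≤ (s≤ O ρ) (t≤ O ρ))

      proj-time : ∀ {Γ a} (t : Term Q A Γ a) → PolyTime t →
                  ∃[ p ] (∀ O ρ {k} → k ≤ size a (value O t ρ) →
                          k + time O t ρ ≤ eval p ∥ ρ ∥)
      proj-time t (p , t≤) = p ⊞ p , λ O ρ k≤ →
        +-mono-≤ (≤-trans k≤ (≤-trans (size≤time O t ρ) (t≤ O ρ))) (t≤ O ρ)

      caseList-time : ∀ {Γ a b} (s : Term Q A Γ (list a)) (t : Term Q A Γ b) u →
                      PolyTime s → PolyTime t → PolyTime u → PolyTime (caseList s t u)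
      caseList-time {Γ} {a} s t u (p , s≤) (q , t≤) (r , u≤) =
        q ⊞ r′ ⊞ (p ⊞ (q ⊞ r′)) , bound
        where
        -- Head and tail together are smaller than the scrutinee, so `u` runs in an environment
        -- larger than `ρ` by at most `p`.
        r′ = r ⊙ (p ⊞ X)
        bound : ∀ O ρ → time O (caseList s t u) ρ ≤ eval (q ⊞ r′ ⊞ (p ⊞ (q ⊞ r′))) ∥ ρ ∥
        bound O ρ with value O s ρ in eq
        ... | [] =
          +-mono-≤ (≤-trans t≤ρ (m≤m+n _ _))
                   (+-mono-≤ (s≤ O ρ) (≤-trans (t≤ O ρ) (m≤m+n _ _)))
          where t≤ρ = ≤-trans (size≤time O t ρ) (t≤ O ρ)
        ... | x ∷ xs =
          +-mono-≤ (≤-trans (≤-trans (size≤time O u _) u≤ρ) (m≤n+m _ (eval q ∥ ρ ∥)))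
                   (+-mono-≤ (s≤ O ρ) (≤-trans u≤ρ (m≤n+m _ (eval q ∥ ρ ∥))))
          where
          x∷xs≤ : size (list a) (x ∷ xs) ≤ eval p ∥ ρ ∥
          x∷xs≤ = subst (λ v → size (list a) v ≤ eval p ∥ ρ ∥) eq
                        (≤-trans (size≤time O s ρ) (s≤ O ρ))
          u≤ρ : time O u (x ∷ xs ∷ ρ) ≤ eval r′ ∥ ρ ∥
          u≤ρ = ≤-trans (u≤ O _) (eval-mono r (≤-trans
            (≤-reflexive (sym (+-assoc (size a x) _ ∥ ρ ∥)))
            (+-monoˡ-≤ ∥ ρ ∥ (≤-trans (n≤1+n _) x∷xs≤))))

      foldTime≤ : ∀ {a : Ty} {C : Set} O (f : ⟦ a ⟧ᵗ → C → C) t z S B →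
                  (∀ x xs → size (list a) (x ∷ xs) ≤ S → t x (foldr f z xs) ≤ B) →
                  ∀ xs → size (list a) xs ≤ S → foldTime O f t z xs ≤ length xs * B
      foldTime≤ O f t z S B step []       _   = z≤n
      foldTime≤ O f t z S B step (x ∷ xs) ≤S  = ≤-trans
        (+-mono-≤ (foldTime≤ O f t z S B step xs
                     (≤-trans (≤-trans (m≤n+m _ _) (n≤1+n _)) ≤S))
                  (step x xs ≤S))
        (≤-reflexive (+-comm (length xs * B) B))

      fold-time : ∀ {Γ a b} (s : Term Q A Γ (list a)) (t : Term Q A Γ b) u →
                  PolyTime s → PolyTime t → PolyTime u → FoldBounded t u →
                  PolyTime (fold s t u)
      fold-time {Γ} {a} {b} s t u (p , s≤) (q , t≤) (r , u≤) (m , acc≤) =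
        m′ ⊞ (p ⊞ q ⊞ p ⊠ r′) , λ O ρ →
          +-mono-≤ (≤-trans (acc≤ O ρ (value O s ρ))
                            (eval-mono m (+-monoˡ-≤ ∥ ρ ∥ (list≤ O ρ))))
            (+-mono-≤ (+-mono-≤ (s≤ O ρ) (t≤ O ρ))
              (≤-trans (foldTime≤ {a} O _ _ _ (eval p ∥ ρ ∥) (eval r′ ∥ ρ ∥)
                          (step≤ O ρ) (value O s ρ) (list≤ O ρ))
                (*-monoˡ-≤ (eval r′ ∥ ρ ∥)
                  (≤-trans (length≤size a (value O s ρ)) (list≤ O ρ)))))
        where
        -- With the list bounded by `p`, `m′` bounds every accumulator. Then `r′` bounds a single
        -- step, whose environment adds one element and one accumulator, and there are at most `p`
        -- steps.
        m′ = m ⊙ (p ⊞ X)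
        r′ = r ⊙ (p ⊞ (m′ ⊞ X))
        list≤ : ∀ O ρ → size (list a) (value O s ρ) ≤ eval p ∥ ρ ∥
        list≤ O ρ = ≤-trans (size≤time O s ρ) (s≤ O ρ)
        step≤ : ∀ O ρ x xs → size (list a) (x ∷ xs) ≤ eval p ∥ ρ ∥ →
                time O u (x ∷ foldr (λ x y → value O u (x ∷ y ∷ ρ)) (value O t ρ) xs ∷ ρ)
                  ≤ eval r′ ∥ ρ ∥
        step≤ O ρ x xs ≤S = ≤-trans (u≤ O _) (eval-mono r
          (+-mono-≤ (≤-trans (≤-trans (m≤m+n (size a x) _) (n≤1+n _)) ≤S)
            (+-monoˡ-≤ ∥ ρ ∥ (≤-trans (acc≤ O ρ xs) (eval-mono m (+-monoˡ-≤ ∥ ρ ∥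
              (≤-trans (≤-trans (m≤n+m _ _) (n≤1+n _)) ≤S)))))))

    polyTime : ∀ {Γ a} (t : Term Q A Γ a) → Tractable t → PolyTime t
    polyTime (var x) _ = X , λ O ρ → ≤-trans (≤-reflexive (+-identityʳ _)) (size-lookup ρ x)
    polyTime (letin s t) (s✓ , t✓) with polyTime s s✓ | polyTime t t✓
    ... | p , s≤ | q , t≤ = q′ ⊞ (p ⊞ q′) , λ O ρ →
        +-mono-≤ (≤-trans (size≤time O t _) (t≤′ O ρ)) (+-mono-≤ (s≤ O ρ) (t≤′ O ρ))
      where
      q′ = q ⊙ (p ⊞ X)
      t≤′ : ∀ O ρ → time O t (value O s ρ ∷ ρ) ≤ eval q′ ∥ ρ ∥
      t≤′ O ρ = ≤-trans (t≤ O _)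
        (eval-mono q (+-monoˡ-≤ ∥ ρ ∥ (≤-trans (size≤time O s ρ) (s≤ O ρ))))
    polyTime (lit k) _ = con (size nat k + 0) , λ O ρ → ≤-refl
    polyTime (add s t) (s✓ , t✓) with op-time s t (polyTime s s✓) (polyTime t t✓)
    ... | p , bound = p , λ O ρ → bound O ρ (size-+ (value O s ρ) (value O t ρ))
    polyTime (monus s t) (s✓ , t✓) with op-time s t (polyTime s s✓) (polyTime t t✓)
    ... | p , bound = p , λ O ρ → bound O ρ
      (≤-trans (size-mono (m∸n≤m (value O s ρ) (value O t ρ)))
               (≤-trans (m≤m+n _ _) (n≤1+n _)))
    polyTime (mul s t) (s✓ , t✓) with op-time s t (polyTime s s✓) (polyTime t t✓)
    ... | p , bound = p , λ O ρ → bound O ρ (size-* (value O s ρ) (value O t ρ))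
    polyTime {a = a} (if s ≤ t then u else v) (s✓ , t✓ , u✓ , v✓)
      with polyTime s s✓ | polyTime t t✓ | polyTime u u✓ | polyTime v v✓
    ... | p , s≤ | q , t≤ | p′ , u≤ | q′ , v≤ = p′ ⊞ q′ ⊞ (p ⊞ q ⊞ (p′ ⊞ q′)) , λ O ρ →
      +-mono-≤
        (branch-elim O (λ x → size a x ≤ eval p′ ∥ ρ ∥ + eval q′ ∥ ρ ∥)
          (value O s ρ) (value O t ρ)
          (λ _ → ≤-trans (≤-trans (size≤time O u ρ) (u≤ O ρ)) (m≤m+n _ _))
          (λ _ → ≤-trans (≤-trans (size≤time O v ρ) (v≤ O ρ)) (m≤n+m _ _)))
        (+-mono-≤ (+-mono-≤ (s≤ O ρ) (t≤ O ρ))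
          (branch-elim O (λ k → k ≤ eval p′ ∥ ρ ∥ + eval q′ ∥ ρ ∥)
            (value O s ρ) (value O t ρ)
            (λ _ → ≤-trans (u≤ O ρ) (m≤m+n _ _))
            (λ _ → ≤-trans (v≤ O ρ) (m≤n+m _ _))))
    polyTime (pair s t) (s✓ , t✓) with op-time s t (polyTime s s✓) (polyTime t t✓)
    ... | p , bound = p , λ O ρ → bound O ρ ≤-refl
    polyTime (fst t) t✓ with proj-time t (polyTime t t✓)
    ... | p , bound = p , λ O ρ → bound O ρ (≤-trans (m≤m+n _ _) (n≤1+n _))
    polyTime (snd t) t✓ with proj-time t (polyTime t t✓)
    ... | p , bound = p , λ O ρ → bound O ρ (≤-trans (m≤n+m _ _) (n≤1+n _))
    polyTime nil _ = con 1 , λ O ρ → ≤-refl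
    polyTime (cons s t) (s✓ , t✓) with op-time s t (polyTime s s✓) (polyTime t t✓)
    ... | p , bound = p , λ O ρ → bound O ρ ≤-refl
    polyTime (caseList s t u) (s✓ , t✓ , u✓) =
      caseList-time s t u (polyTime s s✓) (polyTime t t✓) (polyTime u u✓)
    polyTime (fold s t u) (s✓ , t✓ , u✓ , acc≤) =
      fold-time s t u (polyTime s s✓) (polyTime t t✓) (polyTime u u✓) acc≤

    -- By `indep` each output element is bounded through its own input element and `ρ`, so output
    -- sizes add up along the list instead of compounding.
    map-bounded : ∀ {Γ a b} (t : Term Q A (a ∷ list b ∷ Γ) b) → Tractable t →
                  (∀ O x y ρ → value O t (x ∷ y ∷ ρ) ≡ value O t (x ∷ [] ∷ ρ)) →
                  FoldBounded {Γ} nil (cons t (var (there (here refl))))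
    map-bounded {Γ} {a} {b} t t✓ indep with polyTime t t✓
    ... | p , t≤ = con 1 ⊞ X ⊠ p′ , λ O ρ xs → bound O ρ (size (list a) xs) xs ≤-refl
      where
      p′ = con 1 ⊞ p ⊙ (con 1 ⊞ X)
      -- `S` keeps the size of the whole list while `xs` shrinks, so the bound for one element is
      -- the same throughout the induction.
      bound : ∀ O ρ S xs → size (list a) xs ≤ S →
              size (list b) (foldr (λ x y → value O t (x ∷ y ∷ ρ) ∷ y) [] xs)
                ≤ suc ((size (list a) xs + ∥ ρ ∥) * eval p′ (S + ∥ ρ ∥))
      bound O ρ S []       ≤S = s≤s z≤n
      bound O ρ S (x ∷ xs) ≤S = s≤s (≤-trans
        (+-mono-≤ head≤ (bound O ρ S xs (≤-trans (≤-trans (m≤n+m _ _) (n≤1+n _)) ≤S)))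
        (≤-trans (≤-reflexive (+-suc _ _))
          (+-monoʳ-≤ (eval p′ (S + ∥ ρ ∥))
            (*-monoˡ-≤ (eval p′ (S + ∥ ρ ∥))
              (+-monoˡ-≤ ∥ ρ ∥ (m≤n+m (size (list a) xs) (size a x)))))))
        where
        head≤ : ∀ {y} → size b (value O t (x ∷ y ∷ ρ)) ≤ eval (p ⊙ (con 1 ⊞ X)) (S + ∥ ρ ∥)
        head≤ {y} = ≤-trans (≤-reflexive (cong (size b) (indep O x y ρ)))
          (≤-trans (size≤time O t (x ∷ [] ∷ ρ)) (≤-trans (t≤ O (x ∷ [] ∷ ρ)) (eval-mono p (≤-trans
            (≤-reflexive (+-suc (size a x) ∥ ρ ∥))
            (s≤s (+-monoˡ-≤ ∥ ρ ∥ (≤-trans (≤-trans (m≤m+n _ _) (n≤1+n _)) ≤S)))))))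

-- The program and the bit lengths of its numbers

module Program where

  open PolynomialTime
  open import Data.Nat.Base using (_+_; _*_; _∸_; _^_; _≤_; _<_; z≤n; s≤s)
  open import Data.Nat.Properties hiding (_≟_; _≤?_; _<?_)
  open import Data.Nat.Solver using (module +-*-Solver)

  Frac : Set
  Frac = ⟦ fracᵗ ⟧ᵗ

  infixl 6 _⊕_ _⊖_
  infixl 7 _⊛_ _⊘_

  0ᶠ : Frac
  0ᶠ = 0 , 1

  -- Truncated: f ⊖ g is 0 when f is below g.
  _⊕_ _⊖_ _⊛_ _⊘_ : Frac → Frac → Frac
  (m , d) ⊕ (n , e) = m * e + n * d , d * e
  (m , d) ⊖ (n , e) = m * e ∸ n * d , d * e
  (m , d) ⊛ (n , e) = m * n , d * e
  (m , d) ⊘ (n , e) = m * e , d * n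

  ∁ᶠ : Frac → Frac
  ∁ᶠ (m , d) = d ∸ m , d

  infix 4 _⊑_

  -- The bound is multiplicative under all four operations, so exponents
  -- add up along a fold.
  record _⊑_ (f : Frac) (k : ℕ) : Set where
    constructor bits
    field bound : suc (proj₁ f + proj₂ f) ≤ 2 ^ k

  ⊑-weaken : ∀ {f j k} → j ≤ k → f ⊑ j → f ⊑ k
  ⊑-weaken j≤k (bits f≤) = bits (≤-trans f≤ (^-monoʳ-≤ 2 j≤k))

  0ᶠ⊑ : ∀ {k} → 1 ≤ k → 0ᶠ ⊑ k
  0ᶠ⊑ 1≤k = ⊑-weaken 1≤k (bits ≤-refl)

  private
    -- Expanding the product of the two bounds yields all terms of the bound for the result; `r`
    -- collects the remaining terms.
    ⊑-product : ∀ {f g h : Frac} {j k} r →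
      suc (proj₁ f + proj₂ f) * suc (proj₁ g + proj₂ g) ≡ suc (proj₁ h + proj₂ h) + r →
      f ⊑ j → g ⊑ k → h ⊑ (j + k)
    ⊑-product {j = j} {k} r eq (bits f≤) (bits g≤) = bits (≤-trans (m≤m+n _ r)
      (≤-trans (≤-reflexive (sym eq))
        (≤-trans (*-mono-≤ f≤ g≤) (≤-reflexive (sym (^-distribˡ-+-* 2 j k))))))

    open +-*-Solver using (solve; con; _:=_; _:+_; _:*_)

  ⊑-⊕ : ∀ {f g j k} → f ⊑ j → g ⊑ k → f ⊕ g ⊑ (j + k)
  ⊑-⊕ {m , d} {n , e} = ⊑-product (m * n + m + d + n + e)
    (solve 4 (λ m d n e → (con 1 :+ (m :+ d)) :* (con 1 :+ (n :+ e)) :=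
      con 1 :+ (m :* e :+ n :* d :+ d :* e) :+ (m :* n :+ m :+ d :+ n :+ e)) refl m d n e)

  ⊑-⊛ : ∀ {f g j k} → f ⊑ j → g ⊑ k → f ⊛ g ⊑ (j + k)
  ⊑-⊛ {m , d} {n , e} = ⊑-product (m * e + n * d + m + d + n + e)
    (solve 4 (λ m d n e → (con 1 :+ (m :+ d)) :* (con 1 :+ (n :+ e)) :=
      con 1 :+ (m :* n :+ d :* e) :+ (m :* e :+ n :* d :+ m :+ d :+ n :+ e)) refl m d n e)

  ⊑-⊘ : ∀ {f g j k} → f ⊑ j → g ⊑ k → f ⊘ g ⊑ (j + k)
  ⊑-⊘ {m , d} {n , e} = ⊑-product (m * n + d * e + m + d + n + e)
    (solve 4 (λ m d n e → (con 1 :+ (m :+ d)) :* (con 1 :+ (n :+ e)) :=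
      con 1 :+ (m :* e :+ d :* n) :+ (m :* n :+ d :* e :+ m :+ d :+ n :+ e)) refl m d n e)

  ⊑-⊖ : ∀ {f g j k} → f ⊑ j → g ⊑ k → f ⊖ g ⊑ (j + k)
  ⊑-⊖ {m , d} {n , e} f⊑ g⊑ = bits (≤-trans
    (s≤s (+-monoˡ-≤ (d * e) (≤-trans (m∸n≤m (m * e) (n * d)) (m≤m+n _ (n * d)))))
    (_⊑_.bound (⊑-⊕ f⊑ g⊑)))

  ⊑-∁ : ∀ {f k} → f ⊑ k → ∁ᶠ f ⊑ suc k
  ⊑-∁ {m , d} {k} (bits f≤) = bits (≤-trans
    (s≤s (+-monoˡ-≤ d (m∸n≤m d m)))
    (≤-trans (+-mono-≤ (≤-trans (s≤s (m≤n+m d m)) f≤) (≤-trans (m≤n+m d (suc m)) f≤))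
             (≤-reflexive (cong (2 ^ k +_) (sym (+-identityʳ (2 ^ k)))))))

  ⊑-size : ∀ f → f ⊑ size fracᵗ f
  ⊑-size (m , d) = bits (≤-trans
    (≤-trans (s≤s (≤-trans (m≤m+n (m + d) (m * d)) (≤-reflexive
               (solve 2 (λ m d → m :+ d :+ m :* d := d :+ m :* (con 1 :+ d)) refl m d))))
      (≤-trans (*-mono-≤ (n<2^size m) (n<2^size d))
        (≤-reflexive (sym (^-distribˡ-+-* 2 (size nat m) (size nat d))))))
    (^-monoʳ-≤ 2 (n≤1+n (size nat m + size nat d))))

  size-⊑ : ∀ {f k} → f ⊑ k → size fracᵗ f ≤ suc (suc k + suc k)
  size-⊑ {m , d} {k} (bits f≤) = s≤s (+-mono-≤
    (size≤ {m} {k} (≤-trans (s≤s (m≤m+n m d)) f≤))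
    (size≤ {d} {k} (≤-trans (s≤s (m≤n+m d m)) f≤)))

  T : Ctx → Ty → Set
  T = Term prophetsᵗ orderᵗ

  atomᵗ : Ty
  atomᵗ = fracᵗ ⊗ fracᵗ

  #0 : ∀ {Γ a} → T (a ∷ Γ) a
  #0 = var (here refl)
  #1 : ∀ {Γ a b} → T (a ∷ b ∷ Γ) b
  #1 = var (there (here refl))
  #2 : ∀ {Γ a b c} → T (a ∷ b ∷ c ∷ Γ) c
  #2 = var (there (there (here refl)))
  #3 : ∀ {Γ a b c d} → T (a ∷ b ∷ c ∷ d ∷ Γ) d
  #3 = var (there (there (there (here refl))))
  #4 : ∀ {Γ a b c d e} → T (a ∷ b ∷ c ∷ d ∷ e ∷ Γ) e
  #4 = var (there (there (there (there (here refl)))))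
  #5 : ∀ {Γ a b c d e f} → T (a ∷ b ∷ c ∷ d ∷ e ∷ f ∷ Γ) f
  #5 = var (there (there (there (there (there (here refl))))))
  #6 : ∀ {Γ a b c d e f g} → T (a ∷ b ∷ c ∷ d ∷ e ∷ f ∷ g ∷ Γ) g
  #6 = var (there (there (there (there (there (there (here refl)))))))

  infixl 6 _⊕ᵗ_ _⊖ᵗ_
  infixl 7 _⊛ᵗ_ _⊘ᵗ_

  0ᶠᵗ : ∀ {Γ} → T Γ fracᵗ
  0ᶠᵗ = pair (lit 0) (lit 1)

  _⊕ᵗ_ _⊖ᵗ_ _⊛ᵗ_ _⊘ᵗ_ : ∀ {Γ} → T Γ fracᵗ → T Γ fracᵗ → T Γ fracᵗ
  s ⊕ᵗ t = pair (add (mul (fst s) (snd t)) (mul (fst t) (snd s))) (mul (snd s) (snd t))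
  s ⊖ᵗ t = pair (monus (mul (fst s) (snd t)) (mul (fst t) (snd s))) (mul (snd s) (snd t))
  s ⊛ᵗ t = pair (mul (fst s) (fst t)) (mul (snd s) (snd t))
  s ⊘ᵗ t = pair (mul (fst s) (snd t)) (mul (snd s) (fst t))

  ∁ᵗ : ∀ {Γ} → T Γ fracᵗ → T Γ fracᵗ
  ∁ᵗ t = pair (monus (snd t) (fst t)) (snd t)

  if_≼_then_else_ : ∀ {Γ a} → T Γ fracᵗ → T Γ fracᵗ → T Γ a → T Γ a → T Γ a
  if s ≼ t then u else v = if mul (fst s) (snd t) ≤ mul (fst t) (snd s) then u else v

  -- P(X ≥ r) and 𝔼[X; X ≥ r].
  tail-step : ∀ {Γ} → T (atomᵗ ∷ atomᵗ ∷ Γ) fracᵗ → T (atomᵗ ∷ atomᵗ ∷ Γ) atomᵗ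
  tail-step r = if r ≼ fst #0
                then pair (fst #1 ⊕ᵗ snd #0) (snd #1 ⊕ᵗ snd #0 ⊛ᵗ fst #0)
                else #1

  tailᵗ : ∀ {Γ} → T Γ lawᵗ → T (atomᵗ ∷ atomᵗ ∷ Γ) fracᵗ → T Γ atomᵗ
  tailᵗ law r = fold law (pair 0ᶠᵗ 0ᶠᵗ) (tail-step r)

  boxᵗ : Ty
  boxᵗ = lawᵗ ⊗ fracᵗ

  -- The reservation value s of a box, with 𝔼[(X − s)⁺] = c, is the largest
  -- (𝔼[X; X ≥ v] − c) / P(X ≥ v) over the values v of X.
  threshold-step : ∀ {Γ} → T (atomᵗ ∷ fracᵗ ∷ boxᵗ ∷ Γ) fracᵗ
  threshold-step =
    letin (tailᵗ (fst #2) (fst #2))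
      (if fst (fst #0) ≤ lit 0 then #2 else
        letin ((snd #0 ⊖ᵗ snd #3) ⊘ᵗ fst #0)
          (if #3 ≼ #0 then #0 else #3))

  opaque
    thresholdᵗ : ∀ {Γ} → T (boxᵗ ∷ Γ) fracᵗ
    thresholdᵗ = fold (fst #0) 0ᶠᵗ threshold-step

  cap-atomᵗ : ∀ {Γ} → T (atomᵗ ∷ lawᵗ ∷ fracᵗ ∷ Γ) atomᵗ
  cap-atomᵗ = pair (if fst #0 ≼ #2 then fst #0 else #2) (snd #0)

  cap-withᵗ : ∀ {Γ} → T (fracᵗ ∷ boxᵗ ∷ Γ) lawᵗ
  cap-withᵗ = fold (fst #1) nil (cons cap-atomᵗ #1)

  opaque
    capᵗ : ∀ {Γ} → T (boxᵗ ∷ Γ) lawᵗ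
    capᵗ = letin thresholdᵗ cap-withᵗ

  opaque
    queryᵗ : T (pandoraᵗ ∷ historyᵗ ∷ []) prophetsᵗ
    queryᵗ = fold #0 nil (cons capᵗ #1)

  lengthᵗ : ∀ {Γ a} → T Γ (list a) → T Γ nat
  lengthᵗ t = fold t (lit 0) (add (lit 1) #1)

  -- The language iterates along lists only. Indexing therefore counts down in the state, and the
  -- folded list merely supplies enough iterations.
  drop-step : ∀ {Γ a b} → T (b ∷ nat ⊗ list a ∷ Γ) (nat ⊗ list a)
  drop-step = if lit 1 ≤ fst #1
              then pair (monus (fst #1) (lit 1)) (caseList (snd #1) nil #1)
              else #1

  opaque
    lookupᵗ : ∀ {Γ a} → T Γ (list (list a)) → T Γ nat → T Γ (list a)
    lookupᵗ xs i = caseList (snd (fold xs (pair i xs) drop-step)) nil #0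

  -- Scanning the order from its end: R_t, the next box worth probing, and
  -- the action to be taken once the last observation is known.
  stateᵗ : Ty
  stateᵗ = fracᵗ ⊗ (nat ⊗ nat)

  -- Two comparisons express that the current box is the one probed last. At that box the old state
  -- still describes the boxes after it: its first component is the value to compare with the
  -- observation, and its second the way to continue.
  scan-finish : ∀ {Γ} → T (fracᵗ ∷ atomᵗ ∷ lawᵗ ∷ nat ∷ stateᵗ ∷ (nat ⊗ fracᵗ) ∷ nat ∷ Γ) stateᵗ
  scan-finish = pair #0 (pair
    (if #0 ≼ fst #4 then fst (snd #4) else #3)
    (if #3 ≤ fst #5 then
      (if fst #5 ≤ #3 then
        (if fst #4 ≼ snd #5 then #6 else fst (snd #4))
       else snd (snd #4))
     else snd (snd #4)))

  -- R_t = 𝔼[X; X ≥ r] + P(X < r) · r for r = R_{t+1}: as r occurs only once,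
  -- its bit length grows additively along the scan.
  opaque
    scan-step : ∀ {Γ} → T (nat ∷ stateᵗ ∷ (nat ⊗ fracᵗ) ∷ nat ∷ orderᵗ ∷ prophetsᵗ ∷ Γ) stateᵗ
    scan-step =
      letin (lookupᵗ #5 #0)
      (letin (tailᵗ #0 (fst #4))
      (letin (snd #0 ⊕ᵗ ∁ᵗ (fst #0) ⊛ᵗ fst #3)
      scan-finish))

  -- The number of boxes, which is not the index of a box, means stop.
  opaque
    decisionᵗ : T (orderᵗ ∷ prophetsᵗ ∷ pandoraᵗ ∷ historyᵗ ∷ []) nat
    decisionᵗ =
      letin (lengthᵗ #1)
      (letin (caseList #4 (pair #0 0ᶠᵗ) #0)
      (letin (fold #2 (pair 0ᶠᵗ (pair #1 #1)) scan-step)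
      (caseList #6 (fst (snd #0)) (snd (snd #2)))))

  program : PandoraProgram
  program = letin queryᵗ (letin (ask #0) decisionᵗ)

  -- Running time of the program

  module _ (O : ProphetsOracle) where

    open Semantics {prophetsᵗ} {orderᵗ} O

    module _ (m n : ⟦ atomᵗ ⟧ᵗ → ⟦ atomᵗ ⟧ᵗ → ℕ) where

      -- The test that selects atoms is abstract, because the bit bound holds whichever atoms are
      -- selected.
      sums : ⟦ lawᵗ ⟧ᵗ → ⟦ atomᵗ ⟧ᵗ
      sums = foldr (λ e acc → branch (m e acc) (n e acc)
                (proj₁ acc ⊕ proj₂ e , proj₂ acc ⊕ proj₂ e ⊛ proj₁ e) acc) (0ᶠ , 0ᶠ)

      sums-⊑ : ∀ xs → proj₁ (sums xs) ⊑ size lawᵗ xs × proj₂ (sums xs) ⊑ size lawᵗ xs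
      sums-⊑ [] = 0ᶠ⊑ ≤-refl , 0ᶠ⊑ ≤-refl
      sums-⊑ (e@(v , p) ∷ xs) with sums xs | sums-⊑ xs
      ... | A , B | A⊑ , B⊑ = branch-elim O
        (λ (acc : ⟦ atomᵗ ⟧ᵗ) → proj₁ acc ⊑ k × proj₂ acc ⊑ k)
        (m e (A , B)) (n e (A , B))
        (λ _ → ⊑-weaken (≤-trans (+-monoʳ-≤ l p≤) (≤-reflexive (+-comm l _)))
                 (⊑-⊕ A⊑ (⊑-size p)) ,
               ⊑-weaken (≤-trans (+-monoʳ-≤ l pv≤) (≤-reflexive (+-comm l _)))
                 (⊑-⊕ B⊑ (⊑-⊛ (⊑-size p) (⊑-size v))))
        (λ _ → ⊑-weaken l≤ A⊑ , ⊑-weaken l≤ B⊑)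
        where
        l = size lawᵗ xs
        k = size lawᵗ (e ∷ xs)
        pv≤ : size fracᵗ p + size fracᵗ v ≤ suc (size atomᵗ e)
        pv≤ = ≤-trans (≤-reflexive (+-comm (size fracᵗ p) _)) (≤-trans (n≤1+n _) (n≤1+n _))
        p≤ : size fracᵗ p ≤ suc (size atomᵗ e)
        p≤ = ≤-trans (m≤m+n _ (size fracᵗ v)) pv≤
        l≤ : l ≤ k
        l≤ = m≤n+m l (suc (size atomᵗ e))

    tail-⊑ : ∀ {Γ} (ρ : Env Γ) law (r : T (atomᵗ ∷ atomᵗ ∷ Γ) fracᵗ) →
             let AB = value (tailᵗ law r) ρ ; k = size lawᵗ (value law ρ) in
             proj₁ AB ⊑ k × proj₂ AB ⊑ k
    tail-⊑ ρ law r = sums-⊑ _ _ (value law ρ)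

    threshold-bits : ⟦ boxᵗ ⟧ᵗ → ℕ
    threshold-bits (law , c) = size lawᵗ law + size fracᵗ c + size lawᵗ law

    -- Each candidate is computed afresh from the law (once for each tail sum) and the cost, and the
    -- fold only chooses among candidates, so nothing accumulates.
    threshold-⊑ : ∀ {Γ} (ρ : Env Γ) box es →
      foldr (λ e best → value threshold-step (e ∷ best ∷ box ∷ ρ)) 0ᶠ es ⊑ threshold-bits box
    threshold-⊑ ρ (law , c) [] = 0ᶠ⊑ (≤-trans (1≤size lawᵗ law) (m≤n+m _ (size lawᵗ law + size fracᵗ c)))
    threshold-⊑ ρ box@(law , c) (e ∷ es)
      with foldr (λ e best → value threshold-step (e ∷ best ∷ box ∷ ρ)) 0ᶠ es | threshold-⊑ ρ box es
    ... | best | best⊑ with tail-⊑ (e ∷ best ∷ box ∷ ρ) (fst #2) (fst #2)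
    ... | A⊑ , B⊑ = branch-elim O (_⊑ threshold-bits box) (proj₁ (proj₁ AB)) 0 (λ _ → best⊑) (λ _ →
      branch-elim O (_⊑ threshold-bits box) (proj₁ best * proj₂ q) (proj₁ q * proj₂ best)
        (λ _ → ⊑-⊘ (⊑-⊖ B⊑ (⊑-size c)) A⊑) (λ _ → best⊑))
      where
      AB = value (tailᵗ (fst #2) (fst #2)) (e ∷ best ∷ box ∷ ρ)
      q = (proj₂ AB ⊖ c) ⊘ proj₁ AB

  private
    frac-size : Poly
    frac-size = con 1 ⊞ ((con 1 ⊞ X) ⊞ (con 1 ⊞ X))

  tail-bounded : ∀ {Γ} (r : T (atomᵗ ∷ atomᵗ ∷ Γ) fracᵗ) →
                 FoldBounded (pair 0ᶠᵗ 0ᶠᵗ) (tail-step r)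
  tail-bounded {Γ} r = con 1 ⊞ (frac-size ⊞ frac-size) , bound
    where
    bound : ∀ O (ρ : Env Γ) xs → _
    bound O ρ xs with sums-⊑ O _ _ xs
    ... | A⊑ , B⊑ = s≤s (+-mono-≤
      (≤-trans (size-⊑ A⊑) (eval-mono frac-size (m≤m+n (size lawᵗ xs) ∥ ρ ∥)))
      (≤-trans (size-⊑ B⊑) (eval-mono frac-size (m≤m+n (size lawᵗ xs) ∥ ρ ∥))))

  tail-tractable : ∀ {Γ} (law : T Γ lawᵗ) (r : T (atomᵗ ∷ atomᵗ ∷ Γ) fracᵗ) →
                   Tractable law → Tractable r → Tractable (tailᵗ law r)
  tail-tractable law r law✓ r✓ = law✓ , _ , ((r✓ , _) , (_ , r✓) , _) , tail-bounded r

  threshold-bounded : ∀ {Γ} → FoldBounded {Γ = boxᵗ ∷ Γ} 0ᶠᵗ threshold-step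
  threshold-bounded {Γ} = frac-size ⊙ (X ⊞ X) , bound
    where
    bound : ∀ O (ρ : Env (boxᵗ ∷ Γ)) es → _
    bound O (box@(law , c) ∷ ρ) es = ≤-trans (size-⊑ (threshold-⊑ O ρ box es))
      (eval-mono frac-size (+-mono-≤ (≤-trans lawc≤ (m≤n+m _ (size lawᵗ es)))
        (≤-trans (m≤m+n _ (size fracᵗ c)) (≤-trans lawc≤ (m≤n+m _ (size lawᵗ es))))))
      where
      lawc≤ : size lawᵗ law + size fracᵗ c ≤ size boxᵗ box + ∥ ρ ∥
      lawc≤ = ≤-trans (n≤1+n _) (m≤m+n _ ∥ ρ ∥)

  opaque
    unfolding thresholdᵗ

    threshold-tractable : ∀ {Γ} → Tractable (thresholdᵗ {Γ})
    threshold-tractable = _ , _ , (tail-tractable (fst #2) (fst #2) _ _ , _) , threshold-bounded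

    threshold : ProphetsOracle → ⟦ boxᵗ ⟧ᵗ → Frac
    threshold O box = Semantics.value O thresholdᵗ (box ∷ [])

    threshold-value : ∀ {Γ} O box (ρ : Env Γ) →
                      Semantics.value O thresholdᵗ (box ∷ ρ) ≡ threshold O box
    threshold-value O box ρ = refl

  cap-bounded : ∀ {Γ} → FoldBounded {Γ = fracᵗ ∷ boxᵗ ∷ Γ} nil (cons cap-atomᵗ #1)
  cap-bounded = map-bounded cap-atomᵗ _ (λ O x y ρ → refl)

  opaque
    unfolding capᵗ

    cap-tractable : ∀ {Γ} → Tractable (capᵗ {Γ})
    cap-tractable {Γ} = threshold-tractable {Γ} , (_ , _ , _ , cap-bounded {Γ})

    -- What lets `map-bounded` apply to the query: whatever the accumulator, a capped law depends on
    -- its box alone.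
    cap-value : ∀ {Γ} O box (ρ : Env Γ) → Semantics.value O capᵗ (box ∷ ρ) ≡
                Semantics.value O cap-withᵗ (threshold O box ∷ box ∷ [])
    cap-value O box ρ = cong (λ s → Semantics.value O cap-withᵗ (s ∷ box ∷ ρ))
                             (threshold-value O box ρ)

  opaque
    unfolding queryᵗ

    query-tractable : Tractable queryᵗ
    query-tractable = _ , _ , (cap-tractable , _) ,
      map-bounded capᵗ cap-tractable
        (λ O x y ρ → trans (cap-value O x (y ∷ ρ)) (sym (cap-value O x ([] ∷ ρ))))

  n<2^n : ∀ n → n < 2 ^ n
  n<2^n zero    = s≤s z≤n
  n<2^n (suc n) = ≤-trans (s≤s (n<2^n n))
    (≤-trans (+-monoˡ-≤ (2 ^ n) (m^n>0 2 n))
             (≤-reflexive (cong (2 ^ n +_) (sym (+-identityʳ (2 ^ n))))))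

  length-tractable : ∀ {Γ a} (t : T Γ (list a)) → Tractable t → Tractable (lengthᵗ t)
  length-tractable {Γ} {a} t t✓ = t✓ , _ , _ , con 1 ⊞ X , λ O ρ xs →
    ≤-trans (size≤ {foldr (λ _ n → suc n) 0 xs} (n<2^n _))
            (s≤s (≤-trans (len≤ xs) (m≤m+n _ ∥ ρ ∥)))
    where
    len≤ : ∀ (xs : ⟦ list a ⟧ᵗ) → foldr (λ _ n → suc n) 0 xs ≤ size (list a) xs
    len≤ []       = z≤n
    len≤ (x ∷ xs) = s≤s (≤-trans (len≤ xs) (m≤n+m _ (size a x)))

  module _ (O : ProphetsOracle) where

    open Semantics {prophetsᵗ} {orderᵗ} O

    drop-size : ∀ {Γ a b} (ρ : Env Γ) i (L : ⟦ list a ⟧ᵗ) (xs : ⟦ list b ⟧ᵗ) →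
      let st = foldr (λ x st → value drop-step (x ∷ st ∷ ρ)) (i , L) xs in
      size nat (proj₁ st) ≤ size nat i × size (list a) (proj₂ st) ≤ size (list a) L
    drop-size ρ i L [] = ≤-refl , ≤-refl
    drop-size {a = a} ρ i L (x ∷ xs)
      with foldr (λ x st → value drop-step (x ∷ st ∷ ρ)) (i , L) xs | drop-size ρ i L xs
    ... | j , [] | j≤ , l≤ = branch-elim O
      (λ st → size nat (proj₁ st) ≤ size nat i × size (list a) (proj₂ st) ≤ size (list a) L) 1 j
      (λ _ → ≤-trans (size-mono (m∸n≤m j 1)) j≤ , l≤) (λ _ → j≤ , l≤)
    ... | j , y ∷ ys | j≤ , l≤ = branch-elim O
      (λ st → size nat (proj₁ st) ≤ size nat i × size (list a) (proj₂ st) ≤ size (list a) L) 1 j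
      (λ _ → ≤-trans (size-mono (m∸n≤m j 1)) j≤ ,
             ≤-trans (≤-trans (m≤n+m _ (size a y)) (n≤1+n _)) l≤)
      (λ _ → j≤ , l≤)

    opaque
      unfolding lookupᵗ

      lookup-size : ∀ {Γ a} (ρ : Env Γ) (xs : T Γ (list (list a))) (i : T Γ nat) →
        size (list a) (value (lookupᵗ xs i) ρ) ≤ size (list (list a)) (value xs ρ)
      lookup-size {a = a} ρ xs i
        with foldr (λ x st → value drop-step (x ∷ st ∷ ρ)) (value i ρ , value xs ρ) (value xs ρ)
           | drop-size ρ (value i ρ) (value xs ρ) (value xs ρ)
      ... | j , []     | _ , l≤ = 1≤size (list (list a)) (value xs ρ)
      ... | j , y ∷ ys | _ , l≤ = ≤-trans (≤-trans (m≤m+n _ _) (n≤1+n _)) l≤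

  opaque
    unfolding lookupᵗ

    lookup-tractable : ∀ {Γ a} (xs : T Γ (list (list a))) (i : T Γ nat) →
                       Tractable xs → Tractable i → Tractable (lookupᵗ xs i)
    lookup-tractable {a = a} xs i xs✓ i✓ with polyTime (pair i xs) (i✓ , xs✓)
    ... | p , time≤ = (xs✓ , (i✓ , xs✓) , _ , p , λ O ρ ys →
        let j≤ , l≤ = drop-size O ρ (Semantics.value O i ρ) (Semantics.value O xs ρ) ys in
        ≤-trans (s≤s (+-mono-≤ j≤ l≤))
          (≤-trans (size≤time O (pair i xs) ρ)
            (≤-trans (time≤ O ρ) (eval-mono p (m≤n+m ∥ ρ ∥ _))))) , _

  private
    scan-size : Poly
    scan-size = con 1 ⊞ (frac-size ⊙ (con 1 ⊞ X ⊠ (X ⊞ (con 1 ⊞ X))) ⊞ (con 1 ⊞ (X ⊞ X)))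

  module Scan {Γ} (O : ProphetsOracle) (last : ⟦ nat ⊗ fracᵗ ⟧ᵗ) (stop′ : ℕ)
              (order : ⟦ orderᵗ ⟧ᵗ) (query : ⟦ prophetsᵗ ⟧ᵗ) (ρ′ : Env Γ) where

    open Semantics {prophetsᵗ} {orderᵗ} O

    ρ : Env ((nat ⊗ fracᵗ) ∷ nat ∷ orderᵗ ∷ prophetsᵗ ∷ Γ)
    ρ = last ∷ stop′ ∷ order ∷ query ∷ ρ′

    box-law : ℕ → ⟦ stateᵗ ⟧ᵗ → ⟦ lawᵗ ⟧ᵗ
    box-law o st = value (lookupᵗ #5 #0) (o ∷ st ∷ ρ)

    box-tail : ℕ → ⟦ stateᵗ ⟧ᵗ → ⟦ atomᵗ ⟧ᵗ
    box-tail o st = value (tailᵗ #0 (fst #4)) (box-law o st ∷ o ∷ st ∷ ρ)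

    finish : Frac → ℕ → ⟦ stateᵗ ⟧ᵗ → ⟦ stateᵗ ⟧ᵗ
    finish R′ o st = value scan-finish (R′ ∷ (0ᶠ , 0ᶠ) ∷ [] ∷ o ∷ st ∷ ρ)

    scan : ⟦ orderᵗ ⟧ᵗ → ⟦ stateᵗ ⟧ᵗ
    scan = foldr (λ o st → value scan-step (o ∷ st ∷ ρ)) (0ᶠ , (stop′ , stop′))

    opaque
      unfolding scan-step

      scan-∷ : ∀ o os → let st = scan os ; AB = box-tail o st in
        scan (o ∷ os) ≡ finish (proj₂ AB ⊕ ∁ᶠ (proj₁ AB) ⊛ proj₁ st) o st
      scan-∷ o os = refl

    private
      -- With k = `∥ ρ ∥`, a step multiplies by `∁ᶠ A` (k + 1 bits) and adds `B` (k bits), starting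
      -- from one bit. The two indices are always entries of `os` or `stop′`.
      Bounded : ⟦ orderᵗ ⟧ᵗ → ⟦ stateᵗ ⟧ᵗ → Set
      Bounded os (R , (next , ans)) = R ⊑ (1 + length os * (∥ ρ ∥ + suc ∥ ρ ∥)) ×
        size nat next ≤ size orderᵗ os + ∥ ρ ∥ × size nat ans ≤ size orderᵗ os + ∥ ρ ∥

      stop≤ : size nat stop′ ≤ ∥ ρ ∥
      stop≤ = size-lookup ρ (there (here refl))

      finish-bounded : ∀ AB o os st → proj₁ AB ⊑ ∥ ρ ∥ → proj₂ AB ⊑ ∥ ρ ∥ → Bounded os st →
        Bounded (o ∷ os) (finish (proj₂ AB ⊕ ∁ᶠ (proj₁ AB) ⊛ proj₁ st) o st)
      finish-bounded (A , B) o os (R , (next , ans)) A⊑ B⊑ (R⊑ , next≤ , ans≤) =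
        ⊑-weaken (≤-reflexive eq) (⊑-⊕ B⊑ (⊑-⊛ (⊑-∁ A⊑) R⊑)) ,
        branch-elim O (λ m → size nat m ≤ l′) (proj₁ R′ * proj₂ R) (proj₁ R * proj₂ R′)
          (λ _ → ≤-trans next≤ l≤l′)
          (λ _ → ≤-trans (≤-trans (m≤m+n (size nat o) (size orderᵗ os)) (n≤1+n _)) (m≤m+n _ k)) ,
        branch-elim O (λ m → size nat m ≤ l′) o (proj₁ last)
          (λ _ → branch-elim O (λ m → size nat m ≤ l′) (proj₁ last) o
            (λ _ → branch-elim O (λ m → size nat m ≤ l′)
              (proj₁ R * proj₂ (proj₂ last)) (proj₁ (proj₂ last) * proj₂ R)
              (λ _ → ≤-trans stop≤ (m≤n+m k (size orderᵗ (o ∷ os))))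
              (λ _ → ≤-trans next≤ l≤l′))
            (λ _ → ≤-trans ans≤ l≤l′))
          (λ _ → ≤-trans ans≤ l≤l′)
        where
        k = ∥ ρ ∥
        l′ = size orderᵗ (o ∷ os) + k
        R′ = B ⊕ ∁ᶠ A ⊛ R
        l≤l′ : size orderᵗ os + k ≤ l′
        l≤l′ = +-monoˡ-≤ k (≤-trans (m≤n+m _ (size nat o)) (n≤1+n _))
        eq : k + (suc k + (1 + length os * (k + suc k))) ≡ 1 + length (o ∷ os) * (k + suc k)
        eq = solve 2 (λ k n → k :+ (con 1 :+ k :+ (con 1 :+ n)) := con 1 :+ (k :+ (con 1 :+ k) :+ n))
               refl k (length os * (k + suc k))
          where open +-*-Solver using (solve; con; _:=_; _:+_)

      scan-bits : ∀ os → Bounded os (scan os)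
      scan-bits [] = 0ᶠ⊑ ≤-refl , ≤-trans stop≤ (n≤1+n _) , ≤-trans stop≤ (n≤1+n _)
      scan-bits (o ∷ os) = subst (Bounded (o ∷ os)) (sym (scan-∷ o os))
        (finish-bounded (box-tail o st) o os st
          (⊑-weaken law≤ (proj₁ AB⊑)) (⊑-weaken law≤ (proj₂ AB⊑)) (scan-bits os))
        where
        st = scan os
        AB⊑ = tail-⊑ O (box-law o st ∷ o ∷ st ∷ ρ) #0 (fst #4)
        law≤ : size lawᵗ (box-law o st) ≤ ∥ ρ ∥
        law≤ = ≤-trans (lookup-size O (o ∷ st ∷ ρ) #5 #0)
                       (size-lookup ρ (there (there (there (here refl)))))

    scan-size≤ : ∀ os → size stateᵗ (scan os) ≤ eval scan-size (size orderᵗ os + ∥ ρ ∥)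
    scan-size≤ os = let R⊑ , next≤ , ans≤ = scan-bits os in s≤s (+-mono-≤
      (≤-trans (size-⊑ R⊑) (eval-mono frac-size (s≤s
        (*-mono-≤ (≤-trans (length≤size nat os) (m≤m+n _ ∥ ρ ∥)) (+-mono-≤ k≤ (s≤s k≤))))))
      (s≤s (+-mono-≤ next≤ ans≤)))
      where
      k≤ : ∥ ρ ∥ ≤ size orderᵗ os + ∥ ρ ∥
      k≤ = m≤n+m ∥ ρ ∥ _

  scan-bounded : ∀ {Γ} → FoldBounded {Γ = (nat ⊗ fracᵗ) ∷ nat ∷ orderᵗ ∷ prophetsᵗ ∷ Γ}
                                     (pair 0ᶠᵗ (pair #1 #1)) scan-step
  scan-bounded = scan-size , λ where
    O (last ∷ stop′ ∷ order ∷ query ∷ ρ′) os → Scan.scan-size≤ O last stop′ order query ρ′ os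

  opaque
    unfolding scan-step

    scan-step-tractable : ∀ {Γ} → Tractable (scan-step {Γ})
    scan-step-tractable = lookup-tractable #5 #0 _ _ , tail-tractable #0 (fst #4) _ _ , _

  opaque
    unfolding decisionᵗ

    decision-tractable : Tractable decisionᵗ
    decision-tractable =
      length-tractable #1 _ , _ , (_ , _ , scan-step-tractable , scan-bounded) , _

  -- A list of n indices below n: an index has size at most n + 1, and its list cell adds 1.
  order-size : Poly
  order-size = con 1 ⊞ X ⊠ (con 2 ⊞ X)

  -- `Tractable` excludes `ask`, so the terms before and after the oracle call are bounded
  -- separately and joined here. The hypothesis on the answer is discharged by `answer-size`, where
  -- the query is known to encode an instance.
  program-time : ∃[ p ] (∀ (O : ProphetsOracle) ρ →
    size orderᵗ (O (Semantics.value O queryᵗ ρ)) ≤ eval order-size ∥ ρ ∥ →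
    Semantics.time O program ρ ≤ eval p ∥ ρ ∥)
  program-time with polyTime queryᵗ query-tractable | polyTime decisionᵗ decision-tractable
  ... | p , query≤ | q , decision≤ = q′ ⊞ (p ⊞ (q′ ⊞ (order-size ⊞ (p ⊞ con 0) ⊞ q′))) , bound
    where
    q′ = q ⊙ (order-size ⊞ (p ⊞ X))
    bound : ∀ (O : ProphetsOracle) ρ →
      size orderᵗ (O (Semantics.value O queryᵗ ρ)) ≤ eval order-size ∥ ρ ∥ → _
    bound O ρ order≤ =
      +-mono-≤ value≤ (+-mono-≤ (query≤ O ρ) (+-mono-≤ value≤ (+-mono-≤
        (+-mono-≤ order≤ (+-mono-≤ q≤ ≤-refl)) time≤)))
      where
      open Semantics O
      query = value queryᵗ ρ
      q≤ : size prophetsᵗ query ≤ eval p ∥ ρ ∥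
      q≤ = ≤-trans (size≤time O queryᵗ ρ) (query≤ O ρ)
      time≤ : time decisionᵗ (O query ∷ query ∷ ρ) ≤ eval q′ ∥ ρ ∥
      time≤ = ≤-trans (decision≤ O _)
        (eval-mono q (+-mono-≤ order≤ (+-monoˡ-≤ ∥ ρ ∥ q≤)))
      value≤ : size nat (value decisionᵗ (O query ∷ query ∷ ρ)) ≤ eval q′ ∥ ρ ∥
      value≤ = ≤-trans (size≤time O decisionᵗ _) time≤

open import Data.Rational.Unnormalised.Base as ℚ
  using (ℚᵘ; mkℚᵘ; 0ℚᵘ; 1ℚᵘ; _≃_; *≡*; _≤_; *≤*; _<_; *<*; _+_; _*_; -_; _⊔_; nonNegative)
open import Data.Rational.Unnormalised.Properties as ℚ
  using (≤-refl; ≤-reflexive; ≤-trans; +-mono-≤; ≃-refl; ≃-sym; ≃-trans; +-cong; *-cong)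
import Data.Rational.Unnormalised.Solver as ℚ-Solver
open PolynomialTime
  using (branch-elim; eval; eval≤monomial; length≤size; ∥_∥; size≤; ^-distribʳ-*; 1≤size)
open Program

-- Exactness of the fraction arithmetic, and finite expectations

module Fractions where

  open import Data.Integer.Base as ℤ using (+_; -[1+_])
  import Data.Integer.Properties as ℤ
  open import Data.Nat.Base using (NonZero)
  open import Data.Rational.Unnormalised.Base using (_-_)
  open import Data.Nat.Solver using (module +-*-Solver)

  -- A zero denominator, which no encoding has, is read as 1.
  dec : Frac → ℚᵘ
  dec (m , d) = mkℚᵘ (+ m) (ℕ.pred d)

  Proper : Frac → Set
  Proper (_ , d) = NonZero d

  0≤dec : ∀ f → 0ℚᵘ ≤ dec f
  0≤dec (m , d) = *≤* (subst (+ 0 ℤ.≤_) (sym (ℤ.*-identityʳ (+ m))) (ℤ.+≤+ ℕ.z≤n))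

  dec-encFrac : ∀ {q} → 0ℚᵘ ≤ q → dec (encFrac q) ≡ q
  dec-encFrac {mkℚᵘ (+ n) d}     _ = refl
  dec-encFrac {mkℚᵘ -[1+ n ] d} (*≤* ())

  encFrac-dec : ∀ {f} → Proper f → encFrac (dec f) ≡ f
  encFrac-dec {m , suc d} _ = refl

  encFrac-proper : ∀ q → Proper (encFrac q)
  encFrac-proper (mkℚᵘ n d) = _

  ≼⇒≤ : ∀ {f g} → Proper f → Proper g →
        proj₁ f ℕ.* proj₂ g ℕ.≤ proj₁ g ℕ.* proj₂ f → dec f ≤ dec g
  ≼⇒≤ {m , suc d} {n , suc e} _ _ me≤nd = *≤* (subst₂ ℤ._≤_ (ℤ.pos-* m (suc e)) (ℤ.pos-* n (suc d)) (ℤ.+≤+ me≤nd))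

  ≺⇒< : ∀ {f g} → Proper f → Proper g →
        proj₁ g ℕ.* proj₂ f ℕ.< proj₁ f ℕ.* proj₂ g → dec g < dec f
  ≺⇒< {m , suc d} {n , suc e} _ _ nd<me = *<* (subst₂ ℤ._<_ (ℤ.pos-* n (suc d)) (ℤ.pos-* m (suc e)) (ℤ.+<+ nd<me))

  ≼-elim : ∀ {B : Set} O (P : B → Set) f g {x y} → Proper f → Proper g →
           (dec f ≤ dec g → P x) → (dec g < dec f → P y) →
           P (Semantics.branch {prophetsᵗ} {orderᵗ} O (proj₁ f ℕ.* proj₂ g) (proj₁ g ℕ.* proj₂ f) x y)
  ≼-elim O P f g f✓ g✓ px py = branch-elim O P _ _
    (λ f≼g → px (≼⇒≤ {f} {g} f✓ g✓ f≼g)) (λ g≺f → py (≺⇒< {f} {g} f✓ g✓ g≺f))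

  ⊕-proper : ∀ f g → Proper f → Proper g → Proper (f ⊕ g)
  ⊕-proper (m , suc d) (n , suc e) _ _ = _

  dec-⊕ : ∀ f g → Proper f → Proper g → dec (f ⊕ g) ≡ dec f + dec g
  dec-⊕ (m , suc d) (n , suc e) _ _ = cong (λ z → mkℚᵘ z _)
    (trans (ℤ.pos-+ (m ℕ.* suc e) (n ℕ.* suc d)) (cong₂ ℤ._+_ (ℤ.pos-* m (suc e)) (ℤ.pos-* n (suc d))))

  ⊛-proper : ∀ f g → Proper f → Proper g → Proper (f ⊛ g)
  ⊛-proper (m , suc d) (n , suc e) _ _ = _

  dec-⊛ : ∀ f g → Proper f → Proper g → dec (f ⊛ g) ≡ dec f * dec g
  dec-⊛ (m , suc d) (n , suc e) _ _ = cong (λ z → mkℚᵘ z _) (ℤ.pos-* m n)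

  ⊖-proper : ∀ f g → Proper f → Proper g → Proper (f ⊖ g)
  ⊖-proper (m , suc d) (n , suc e) _ _ = _

  dec-⊖ : ∀ f g → Proper f → Proper g → dec g ≤ dec f → dec (f ⊖ g) ≡ dec f - dec g
  dec-⊖ (m , suc d) (n , suc e) _ _ (*≤* g≤f) = cong (λ z → mkℚᵘ z _) (begin
    + (m ℕ.* suc e ℕ.∸ n ℕ.* suc d)
      ≡⟨ ℤ.⊖-≥ (ℤ.drop‿+≤+ (subst₂ ℤ._≤_ (sym (ℤ.pos-* n (suc d))) (sym (ℤ.pos-* m (suc e))) g≤f)) ⟨
    m ℕ.* suc e ℤ.⊖ n ℕ.* suc d
      ≡⟨ ℤ.m-n≡m⊖n (m ℕ.* suc e) (n ℕ.* suc d) ⟨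
    + (m ℕ.* suc e) ℤ.- + (n ℕ.* suc d)
      ≡⟨ cong₂ ℤ._+_ (ℤ.pos-* m (suc e))
           (trans (cong ℤ.-_ (ℤ.pos-* n (suc d))) (ℤ.neg-distribˡ-* (+ n) (+ suc d))) ⟩
    + m ℤ.* + suc e ℤ.+ (ℤ.- + n) ℤ.* + suc d ∎)
    where
    open ≡-Reasoning

  ⊖-zero : ∀ f g → Proper f → Proper g → dec f ≤ dec g → proj₁ (f ⊖ g) ≡ 0
  ⊖-zero (m , suc d) (n , suc e) _ _ (*≤* f≤g) =
    ℕ.m≤n⇒m∸n≡0 (ℤ.drop‿+≤+ (subst₂ ℤ._≤_ (sym (ℤ.pos-* m (suc e))) (sym (ℤ.pos-* n (suc d))) f≤g))

  dec-zero : ∀ {f} → proj₁ f ≡ 0 → dec f ≃ 0ℚᵘ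
  dec-zero refl = *≡* refl

  ⊘-proper : ∀ f g → Proper f → 0 ℕ.< proj₁ g → Proper (f ⊘ g)
  ⊘-proper (m , suc d) (suc n , e) _ _ = _

  -- Written as a product, the form in which a candidate `q` later enters c + q · P(X ≥ v).
  dec-⊘ : ∀ f g → Proper f → Proper g → 0 ℕ.< proj₁ g → dec (f ⊘ g) * dec g ≃ dec f
  dec-⊘ (m , suc d) (suc n , suc e) _ _ _ = *≡* (begin
    (+ (m ℕ.* suc e) ℤ.* + suc n) ℤ.* + suc d
      ≡⟨ cong (ℤ._* + suc d) (ℤ.pos-* (m ℕ.* suc e) (suc n)) ⟨
    + (m ℕ.* suc e ℕ.* suc n) ℤ.* + suc d
      ≡⟨ ℤ.pos-* (m ℕ.* suc e ℕ.* suc n) (suc d) ⟨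
    + (m ℕ.* suc e ℕ.* suc n ℕ.* suc d)
      ≡⟨ cong +_ (solve 4 (λ m d n e → m :* e :* n :* d := m :* (d :* n :* e)) refl m (suc d) (suc n) (suc e)) ⟩
    + (m ℕ.* (suc d ℕ.* suc n ℕ.* suc e))
      ≡⟨ ℤ.pos-* m (suc d ℕ.* suc n ℕ.* suc e) ⟩
    + m ℤ.* + (suc d ℕ.* suc n ℕ.* suc e) ∎)
    where
    open +-*-Solver using (solve; _:=_; _:*_)
    open ≡-Reasoning

  ∁-proper : ∀ f → Proper f → Proper (∁ᶠ f)
  ∁-proper (m , suc d) _ = _

  dec-∁ : ∀ f → Proper f → dec f ≤ 1ℚᵘ → dec (∁ᶠ f) ≡ 1ℚᵘ - dec f
  dec-∁ f@(m , suc d) f✓ f≤1 = trans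
    (cong dec (cong₂ _,_ (cong₂ ℕ._∸_ (sym (ℕ.*-identityˡ (suc d))) (sym (ℕ.*-identityʳ m)))
                         (sym (ℕ.*-identityˡ (suc d)))))
    (dec-⊖ (1 , 1) f _ f✓ f≤1)

  -- Expectations

  +-cancelʳ-≤ : ∀ {p q} r → p + r ≤ q + r → p ≤ q
  +-cancelʳ-≤ {p} {q} r p+r≤q+r = begin
    p             ≃⟨ cancel p ⟨
    p + r - r     ≤⟨ ℚ.+-monoˡ-≤ (- r) p+r≤q+r ⟩
    q + r - r     ≃⟨ cancel q ⟩
    q             ∎
    where
    open ℚ.≤-Reasoning
    cancel : ∀ x → x + r - r ≃ x
    cancel x = ≃-trans (ℚ.+-assoc x r (- r))
      (≃-trans (ℚ.+-congʳ x (ℚ.+-inverseʳ r)) (ℚ.+-identityʳ x))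

  *-monoʳ-≤ : ∀ {r p q} → 0ℚᵘ ≤ r → p ≤ q → r * p ≤ r * q
  *-monoʳ-≤ {r} 0≤r = ℚ.*-monoʳ-≤-nonNeg r {{nonNegative 0≤r}}

  *-monoˡ-≤ : ∀ {r p q} → 0ℚᵘ ≤ r → p ≤ q → p * r ≤ q * r
  *-monoˡ-≤ {r} 0≤r = ℚ.*-monoˡ-≤-nonNeg r {{nonNegative 0≤r}}

  Law : Set
  Law = List (ℚᵘ × ℚᵘ)

  Weighted : Law → Set
  Weighted = All (λ (_ , p) → 0ℚᵘ ≤ p)

  expect-mono : ∀ {L f g} → Weighted L → All (λ (v , _) → f v ≤ g v) L → expect L f ≤ expect L g
  expect-mono []         []         = ≤-refl
  expect-mono (0≤p ∷ ps) (f≤g ∷ fs) = +-mono-≤ (*-monoʳ-≤ 0≤p f≤g) (expect-mono ps fs)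

  expect-cong : ∀ L {f g} → (∀ v → f v ≃ g v) → expect L f ≃ expect L g
  expect-cong []            f≃g = ≃-refl
  expect-cong ((v , p) ∷ L) f≃g = +-cong (ℚ.*-congˡ {p} (f≃g v)) (expect-cong L f≃g)

  expect-+ : ∀ L f g → expect L (λ v → f v + g v) ≃ expect L f + expect L g
  expect-+ []            f g = ≃-refl
  expect-+ ((v , p) ∷ L) f g = ≃-trans
    (+-cong (ℚ.*-distribˡ-+ p (f v) (g v)) (expect-+ L f g))
    (solve 4 (λ a b c d → (a :+ b) :+ (c :+ d) := (a :+ c) :+ (b :+ d)) ≃-refl
       (p * f v) (p * g v) (expect L f) (expect L g))
    where open ℚ-Solver.+-*-Solver

  expect-*ʳ : ∀ L f k → expect L (λ v → f v * k) ≃ expect L f * k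
  expect-*ʳ []            f k = ≃-sym (ℚ.*-zeroˡ k)
  expect-*ʳ ((v , p) ∷ L) f k = ≃-trans
    (+-cong (≃-sym (ℚ.*-assoc p (f v) k)) (expect-*ʳ L f k))
    (≃-sym (ℚ.*-distribʳ-+ k (p * f v) (expect L f)))

  Normalised : Law → Set
  Normalised L = expect L (λ _ → 1ℚᵘ) ≃ 1ℚᵘ

  expect-const : ∀ {L} → Normalised L → ∀ k → expect L (λ _ → k) ≃ k
  expect-const {L} mass k = ≃-trans (expect-cong L (λ _ → ≃-sym (ℚ.*-identityˡ k)))
    (≃-trans (expect-*ʳ L (λ _ → 1ℚᵘ) k)
      (≃-trans (*-cong mass (≃-refl {k})) (ℚ.*-identityˡ k)))

  expect-shift : ∀ {L} → Normalised L → ∀ f k → expect L (λ v → f v + k) ≃ expect L f + k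
  expect-shift {L} mass f k = ≃-trans (expect-+ L f (λ _ → k)) (ℚ.+-congʳ (expect L f) (expect-const {L} mass k))

  expect-swap : ∀ L M (f : ℚᵘ → ℚᵘ → ℚᵘ) →
                expect L (λ x → expect M (f x)) ≃ expect M (λ y → expect L (λ x → f x y))
  expect-swap L [] f = ≃-trans
    (≃-trans (expect-cong L (λ _ → ≃-sym (ℚ.*-zeroʳ 1ℚᵘ))) (expect-*ʳ L (λ _ → 1ℚᵘ) 0ℚᵘ))
    (ℚ.*-zeroʳ (expect L (λ _ → 1ℚᵘ)))
  expect-swap L ((y , q) ∷ M) f = ≃-trans (expect-+ L (λ x → q * f x y) (λ x → expect M (f x)))
    (+-cong (≃-trans (expect-cong L (λ x → ℚ.*-comm q (f x y)))
               (≃-trans (expect-*ʳ L (λ x → f x y) q) (ℚ.*-comm _ q)))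
            (expect-swap L M f))

-- Tail sums, reservation values and capped variables

module Reservation where

  open Fractions
  import Data.Integer.Base as ℤ
  open import Data.Rational.Unnormalised.Base using (_-_)

  -- As a rational factor, the indicator keeps tail sums within the linearity lemmas for `expect`.
  χ : ℚᵘ → ℚᵘ → ℚᵘ
  χ r v with r ℚ.≤? v
  ... | yes _ = 1ℚᵘ
  ... | no  _ = 0ℚᵘ

  χ-elim : ∀ (P : ℚᵘ → Set) {r v} → (r ≤ v → P 1ℚᵘ) → (v < r → P 0ℚᵘ) → P (χ r v)
  χ-elim P {r} {v} p₁ p₀ with r ℚ.≤? v
  ... | yes r≤v = p₁ r≤v
  ... | no  r≰v = p₀ (ℚ.≰⇒> r≰v)

  0≤χ : ∀ r v → 0ℚᵘ ≤ χ r v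
  0≤χ r v = χ-elim (0ℚᵘ ≤_) {r} {v} (λ _ → *≤* (ℤ.+≤+ ℕ.z≤n)) (λ _ → ≤-refl)

  χ≤1 : ∀ r v → χ r v ≤ 1ℚᵘ
  χ≤1 r v = χ-elim (_≤ 1ℚᵘ) {r} {v} (λ _ → ≤-refl) (λ _ → *≤* (ℤ.+≤+ ℕ.z≤n))

  mass≥ part≥ : Law → ℚᵘ → ℚᵘ
  mass≥ L r = expect L (χ r)
  part≥ L r = expect L (λ v → χ r v * v)

  NonNegLaw : Law → Set
  NonNegLaw L = All (λ (v , _) → 0ℚᵘ ≤ v) L × Weighted L

  encLaw′ : Law → ⟦ lawᵗ ⟧ᵗ
  encLaw′ = map (λ (v , p) → encFrac v , encFrac p)

  module _ (O : ProphetsOracle) where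

    open Semantics {prophetsᵗ} {orderᵗ} O

    tails : Frac → ⟦ lawᵗ ⟧ᵗ → ⟦ atomᵗ ⟧ᵗ
    tails r = foldr (λ e acc → branch (proj₁ r ℕ.* proj₂ (proj₁ e)) (proj₁ (proj₁ e) ℕ.* proj₂ r)
      (proj₁ acc ⊕ proj₂ e , proj₂ acc ⊕ proj₂ e ⊛ proj₁ e) acc) (0ᶠ , 0ᶠ)

    record Represents (AB : ⟦ atomᵗ ⟧ᵗ) (a b : ℚᵘ) : Set where
      field
        mass-proper : Proper (proj₁ AB)
        part-proper : Proper (proj₂ AB)
        mass≃       : dec (proj₁ AB) ≃ a
        part≃       : dec (proj₂ AB) ≃ b

    tails-correct : ∀ {r} → Proper r → ∀ {L} → NonNegLaw L →
                    Represents (tails r (encLaw′ L)) (mass≥ L (dec r)) (part≥ L (dec r))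
    tails-correct r✓ {[]} _ = record
      { mass-proper = _ ; part-proper = _ ; mass≃ = ≃-refl ; part≃ = ≃-refl }
    tails-correct {r} r✓ {(v , p) ∷ L} (0≤v ∷ vs , 0≤p ∷ ps) =
      ≼-elim O (λ AB → Represents AB (mass≥ ((v , p) ∷ L) (dec r)) (part≥ ((v , p) ∷ L) (dec r)))
        r (encFrac v) r✓ v✓
        (λ r≤v → let χ≃1 = 1≃χ (subst (dec r ≤_) (dec-encFrac 0≤v) r≤v) in record
          { mass-proper = ⊕-proper (proj₁ AB) (encFrac p) A✓ p✓
          ; part-proper = ⊕-proper (proj₂ AB) (encFrac p ⊛ encFrac v) B✓ pv✓
          ; mass≃ = begin
              dec (proj₁ AB ⊕ encFrac p)          ≡⟨ dec-⊕ (proj₁ AB) (encFrac p) A✓ p✓ ⟩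
              dec (proj₁ AB) + dec (encFrac p)    ≡⟨ cong (dec (proj₁ AB) +_) (dec-encFrac 0≤p) ⟩
              dec (proj₁ AB) + p                  ≈⟨ +-cong (mass≃ ih) (≃-sym (ℚ.*-identityʳ p)) ⟩
              mass≥ L (dec r) + p * 1ℚᵘ           ≈⟨ ℚ.+-comm _ (p * 1ℚᵘ) ⟩
              p * 1ℚᵘ + mass≥ L (dec r)           ≈⟨ ℚ.+-congˡ _ (ℚ.*-congˡ {p} χ≃1) ⟩
              p * χ (dec r) v + mass≥ L (dec r)   ∎
          ; part≃ = begin
              dec (proj₂ AB ⊕ encFrac p ⊛ encFrac v)
                ≡⟨ dec-⊕ (proj₂ AB) (encFrac p ⊛ encFrac v) B✓ pv✓ ⟩
              dec (proj₂ AB) + dec (encFrac p ⊛ encFrac v)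
                ≡⟨ cong (dec (proj₂ AB) +_) (trans (dec-⊛ (encFrac p) (encFrac v) p✓ v✓) (cong₂ _*_ (dec-encFrac 0≤p) (dec-encFrac 0≤v))) ⟩
              dec (proj₂ AB) + p * v
                ≈⟨ +-cong (part≃ ih) (ℚ.*-congˡ {p} (≃-trans (≃-sym (ℚ.*-identityˡ v)) (ℚ.*-congʳ {v} χ≃1))) ⟩
              part≥ L (dec r) + p * (χ (dec r) v * v)
                ≈⟨ ℚ.+-comm _ (p * (χ (dec r) v * v)) ⟩
              p * (χ (dec r) v * v) + part≥ L (dec r) ∎ })
        (λ v<r → let χ≃0 = 0≃χ (subst (_< dec r) (dec-encFrac 0≤v) v<r) in record
          { mass-proper = A✓ ; part-proper = B✓
          ; mass≃ = begin
              dec (proj₁ AB)                      ≈⟨ mass≃ ih ⟩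
              mass≥ L (dec r)                     ≈⟨ ℚ.+-identityˡ _ ⟨
              0ℚᵘ + mass≥ L (dec r)               ≈⟨ ℚ.+-congˡ _ (≃-trans (≃-sym (ℚ.*-zeroʳ p)) (ℚ.*-congˡ {p} χ≃0)) ⟩
              p * χ (dec r) v + mass≥ L (dec r)   ∎
          ; part≃ = begin
              dec (proj₂ AB)                            ≈⟨ part≃ ih ⟩
              part≥ L (dec r)                           ≈⟨ ℚ.+-identityˡ _ ⟨
              0ℚᵘ + part≥ L (dec r)
                ≈⟨ ℚ.+-congˡ _ (≃-trans (≃-sym (ℚ.*-zeroʳ p)) (ℚ.*-congˡ {p}
                     (≃-trans (≃-sym (ℚ.*-zeroˡ v)) (ℚ.*-congʳ {v} χ≃0)))) ⟩
              p * (χ (dec r) v * v) + part≥ L (dec r)   ∎ })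
      where
      open Represents
      AB = tails r (encLaw′ L)
      ih = tails-correct {r} r✓ {L} (vs , ps)
      A✓ = mass-proper ih
      B✓ = part-proper ih
      p✓ = encFrac-proper p
      v✓ = encFrac-proper v
      pv✓ : Proper (encFrac p ⊛ encFrac v)
      pv✓ = _
      1≃χ : dec r ≤ v → 1ℚᵘ ≃ χ (dec r) v
      1≃χ r≤v = χ-elim (1ℚᵘ ≃_) {dec r} {v} (λ _ → ≃-refl) (λ v<r → contradiction r≤v (ℚ.<⇒≱ v<r))
      0≃χ : v < dec r → 0ℚᵘ ≃ χ (dec r) v
      0≃χ v<r = χ-elim (0ℚᵘ ≃_) {dec r} {v} (λ r≤v → contradiction r≤v (ℚ.<⇒≱ v<r)) (λ _ → ≃-refl)
      open import Relation.Binary.Reasoning.Setoid ℚ.≃-setoid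

  module _ {L : Law} (L≥0 : NonNegLaw L) (mass : Normalised L) where

    private
      vs = proj₁ L≥0
      ps = proj₂ L≥0

    0≤mass≥ : ∀ r → 0ℚᵘ ≤ mass≥ L r
    0≤mass≥ r = ≤-trans (≤-reflexive (≃-sym (expect-const {L} mass 0ℚᵘ)))
      (expect-mono ps (All.map (λ {(v , _)} _ → 0≤χ r v) vs))

    mass≥≤1 : ∀ r → mass≥ L r ≤ 1ℚᵘ
    mass≥≤1 r = ≤-trans (expect-mono ps (All.map (λ {(v , _)} _ → χ≤1 r v) vs)) (≤-reflexive mass)

    private
      ceiling : ∀ (M : Law) → ∃[ m ] All (λ (v , _) → v ≤ m) M
      ceiling [] = 0ℚᵘ , []
      ceiling ((v , _) ∷ M) with ceiling M
      ... | m , M≤m = v ⊔ m , ℚ.p≤p⊔q v m ∷ All.map (λ v≤m → ≤-trans v≤m (ℚ.p≤q⊔p v m)) M≤m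

    -- With m an upper bound of the values, the partial expectation is at most m · P(X ≥ r) = 0.
    -- This settles the values at which the quotient defining a candidate would divide by zero.
    part≥≤0 : ∀ {r} → mass≥ L r ≤ 0ℚᵘ → part≥ L r ≤ 0ℚᵘ
    part≥≤0 {r} massr≤0 with ceiling L
    ... | m , L≤m = begin
      part≥ L r                       ≤⟨ expect-mono ps (All.map (λ {(v , _)} v≤m → *-monoʳ-≤ (0≤χ r v) v≤m) L≤m) ⟩
      expect L (λ v → χ r v * m)      ≃⟨ expect-*ʳ L (χ r) m ⟩
      mass≥ L r * m                   ≃⟨ ℚ.*-congʳ {m} (ℚ.≤-antisym massr≤0 (0≤mass≥ r)) ⟩
      0ℚᵘ * m                         ≃⟨ ℚ.*-zeroˡ m ⟩
      0ℚᵘ                             ∎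
      where open ℚ.≤-Reasoning

    private
      sumˡ : ∀ r s → expect L (λ v → χ r v * v + s) ≃ part≥ L r + s
      sumˡ r s = expect-shift {L} mass (λ v → χ r v * v) s
      sumʳ : ∀ r s → expect L (λ v → v ⊔ s + χ r v * s) ≃ expect L (_⊔ s) + mass≥ L r * s
      sumʳ r s = ≃-trans (expect-+ L (_⊔ s) (λ v → χ r v * s))
                         (ℚ.+-congʳ (expect L (_⊔ s)) (expect-*ʳ L (χ r) s))

    -- Rearranged, 𝔼[X - s; X ≥ r] ≤ 𝔼[(X - s)⁺], with 𝔼[(X - s)⁺] written as 𝔼[X ⊔ s] - s: a
    -- positive part dominates on every event.
    part≥-upper : ∀ r s → part≥ L r + s ≤ expect L (_⊔ s) + mass≥ L r * s
    part≥-upper r s = begin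
      part≥ L r + s                               ≃⟨ sumˡ r s ⟨
      expect L (λ v → χ r v * v + s)              ≤⟨ expect-mono ps (All.map (λ {(v , _)} _ → pointwise v) vs) ⟩
      expect L (λ v → v ⊔ s + χ r v * s)          ≃⟨ sumʳ r s ⟩
      expect L (_⊔ s) + mass≥ L r * s             ∎
      where
      open ℚ.≤-Reasoning
      pointwise : ∀ v → χ r v * v + s ≤ v ⊔ s + χ r v * s
      pointwise v = χ-elim (λ x → x * v + s ≤ v ⊔ s + x * s) {r} {v}
        (λ _ → +-mono-≤ (≤-trans (≤-reflexive (ℚ.*-identityˡ v)) (ℚ.p≤p⊔q v s))
                        (≤-reflexive (≃-sym (ℚ.*-identityˡ s))))
        (λ _ → ≤-trans (≤-reflexive (≃-trans (ℚ.+-congˡ s (ℚ.*-zeroˡ v)) (ℚ.+-comm 0ℚᵘ s)))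
                       (+-mono-≤ (ℚ.p≤q⊔p v s) (≤-reflexive (≃-sym (ℚ.*-zeroˡ s)))))

    -- The reverse inequality holds when X - s is nonnegative on the event X ≥ r and nonpositive off
    -- it.
    part≥-lower : ∀ r s → All (λ (v , _) → (r ≤ v → s ≤ v) × (v < r → v ≤ s)) L →
                  expect L (_⊔ s) + mass≥ L r * s ≤ part≥ L r + s
    part≥-lower r s split = begin
      expect L (_⊔ s) + mass≥ L r * s             ≃⟨ sumʳ r s ⟨
      expect L (λ v → v ⊔ s + χ r v * s)          ≤⟨ expect-mono ps (All.map (λ {(v , _)} → pointwise v) split) ⟩
      expect L (λ v → χ r v * v + s)              ≃⟨ sumˡ r s ⟩
      part≥ L r + s                               ∎
      where
      open ℚ.≤-Reasoning
      pointwise : ∀ v → (r ≤ v → s ≤ v) × (v < r → v ≤ s) → v ⊔ s + χ r v * s ≤ χ r v * v + s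
      pointwise v (above , below) = χ-elim (λ x → v ⊔ s + x * s ≤ x * v + s) {r} {v}
        (λ r≤v → +-mono-≤ (≤-reflexive (≃-trans (ℚ.p≥q⇒p⊔q≃p (above r≤v)) (≃-sym (ℚ.*-identityˡ v))))
                          (≤-reflexive (ℚ.*-identityˡ s)))
        (λ v<r → ≤-trans (+-mono-≤ (≤-reflexive (ℚ.p≤q⇒p⊔q≃q (below v<r))) (≤-reflexive (ℚ.*-zeroˡ s)))
                         (≤-reflexive (≃-trans (ℚ.+-comm s 0ℚᵘ) (ℚ.+-congˡ s (≃-sym (ℚ.*-zeroˡ v))))))

  -- Reservation values

  module _ {L : Law} (L≥0 : NonNegLaw L) (mass : Normalised L) {c : ℚᵘ} (0≤c : 0ℚᵘ ≤ c) where

    private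
      vs = proj₁ L≥0
      ps = proj₂ L≥0

      -- The least value r above s, if there is one. Then X ≥ r is the same event as X > s, but cut
      -- at a value where `Q` is known.
      pivot : ∀ {Q : ℚᵘ → Set} s {M : Law} → All (λ (v , _) → Q v) M →
        All (λ (v , _) → v ≤ s) M ⊎
        ∃[ r ] Q r × s < r × All (λ (v , _) → v < r → v ≤ s) M
      pivot s [] = inj₁ []
      pivot s {(v , _) ∷ M} (Qv ∷ QM) with pivot s QM | v ℚ.≤? s
      ... | inj₁ M≤s                  | yes v≤s = inj₁ (v≤s ∷ M≤s)
      ... | inj₁ M≤s                  | no  v≰s =
        inj₂ (v , Qv , ℚ.≰⇒> v≰s , (λ v<v → contradiction v<v (ℚ.<-irrefl ≃-refl)) ∷ All.map (λ w≤s _ → w≤s) M≤s)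
      ... | inj₂ (r , Qr , s<r , M<r) | yes v≤s = inj₂ (r , Qr , s<r , (λ _ → v≤s) ∷ M<r)
      ... | inj₂ (r , Qr , s<r , M<r) | no  v≰s with r ℚ.≤? v
      ...   | yes r≤v = inj₂ (r , Qr , s<r , (λ v<r → contradiction r≤v (ℚ.<⇒≱ v<r)) ∷ M<r)
      ...   | no  r≰v = inj₂ (v , Qv , ℚ.≰⇒> v≰s , (λ v<v → contradiction v<v (ℚ.<-irrefl ≃-refl)) ∷
                          All.map (λ w≤s w<v → w≤s (ℚ.<-trans w<v (ℚ.≰⇒> r≰v))) M<r)

    -- At the least value r above s, 𝔼[(X - s)⁺] equals 𝔼[X - s; X ≥ r], and the hypothesis at r
    -- bounds this by c. Hence it is enough to test thresholds at the values of X.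
    excess-upper : ∀ {s} → All (λ (v , _) → part≥ L v ≤ c + s * mass≥ L v) L →
                   expect L (_⊔ s) ≤ s + c
    excess-upper {s} covers with pivot {λ v → part≥ L v ≤ c + s * mass≥ L v} s covers
    ... | inj₁ L≤s = begin
      expect L (_⊔ s)     ≤⟨ expect-mono ps (All.map (λ {(v , _)} v≤s → ≤-reflexive (ℚ.p≤q⇒p⊔q≃q v≤s)) L≤s) ⟩
      expect L (λ _ → s)  ≃⟨ expect-const {L} mass s ⟩
      s                   ≤⟨ ℚ.p≤p+q s c {{nonNegative 0≤c}} ⟩
      s + c               ∎
      where open ℚ.≤-Reasoning
    ... | inj₂ (r , cover , s<r , below) = +-cancelʳ-≤ (mass≥ L r * s) (begin
      expect L (_⊔ s) + mass≥ L r * s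
        ≤⟨ part≥-lower L≥0 mass r s (All.map (λ b → (λ r≤v → ≤-trans (ℚ.<⇒≤ s<r) r≤v) , b) below) ⟩
      part≥ L r + s
        ≤⟨ ℚ.+-monoˡ-≤ s cover ⟩
      c + s * mass≥ L r + s
        ≃⟨ solve 3 (λ c s a → c :+ s :* a :+ s := s :+ c :+ a :* s) ≃-refl c s (mass≥ L r) ⟩
      s + c + mass≥ L r * s ∎)
      where
      open ℚ.≤-Reasoning
      open ℚ-Solver.+-*-Solver

    excess-lower : ∀ {s r} → part≥ L r ≃ c + s * mass≥ L r → s + c ≤ expect L (_⊔ s)
    excess-lower {s} {r} tight = +-cancelʳ-≤ (mass≥ L r * s) (begin
      s + c + mass≥ L r * s
        ≃⟨ solve 3 (λ c s a → s :+ c :+ a :* s := c :+ s :* a :+ s) ≃-refl c s (mass≥ L r) ⟩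
      c + s * mass≥ L r + s
        ≃⟨ ℚ.+-congˡ s tight ⟨
      part≥ L r + s
        ≤⟨ part≥-upper L≥0 mass r s ⟩
      expect L (_⊔ s) + mass≥ L r * s ∎)
      where
      open ℚ.≤-Reasoning
      open ℚ-Solver.+-*-Solver

    -- The equation 𝔼[(X - s)⁺] = c as two inequalities. At s = 0, which may stand in for a negative
    -- solution, only the first is guaranteed.
    record IsReservation (s : ℚᵘ) : Set where
      field
        excess≤ : expect L (_⊔ s) ≤ s + c
        excess≥ : s ≃ 0ℚᵘ ⊎ s + c ≤ expect L (_⊔ s)

    module _ {s : ℚᵘ} (reservation : IsReservation s) (cap : ℚᵘ → ℚᵘ)
             (cap-spec : ∀ {v} → 0ℚᵘ ≤ v → (v ≤ s × cap v ≃ v) ⊎ (s < v × cap v ≃ s)) where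

      open IsReservation reservation

      -- The excess above s of a box opened at continuation value r is paid
      -- for by its cost when r ≤ s; when s ≤ r the box is not worth opening.
      private
        caps : All (λ (v , _) → (v ≤ s × cap v ≃ v) ⊎ (s < v × cap v ≃ s)) L
        caps = All.map cap-spec vs

        -- Put e = (v ⊔ s) - s, so that e ≥ 0 and v = cap v + e. Then (cap v + e) ⊔ r ≤ (cap v ⊔ r)
        -- + e.
        sum-below : ∀ r → expect L (_⊔ r) + s ≤ expect L (λ v → cap v ⊔ r) + expect L (_⊔ s)
        sum-below r = begin
          expect L (_⊔ r) + s                   ≃⟨ expect-shift {L} mass (_⊔ r) s ⟨
          expect L (λ v → v ⊔ r + s)            ≤⟨ expect-mono ps (All.map (λ {(v , _)} → pointwise v) caps) ⟩
          expect L (λ v → cap v ⊔ r + (v ⊔ s))  ≃⟨ expect-+ L (λ v → cap v ⊔ r) (_⊔ s) ⟩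
          expect L (λ v → cap v ⊔ r) + expect L (_⊔ s) ∎
          where
          open ℚ.≤-Reasoning
          pointwise : ∀ v → (v ≤ s × cap v ≃ v) ⊎ (s < v × cap v ≃ s) → v ⊔ r + s ≤ cap v ⊔ r + (v ⊔ s)
          pointwise v (inj₁ (v≤s , cap≃v)) =
            ≤-reflexive (+-cong (ℚ.⊔-congʳ r (≃-sym cap≃v)) (≃-sym (ℚ.p≤q⇒p⊔q≃q v≤s)))
          pointwise v (inj₂ (s<v , cap≃s)) with ℚ.≤-total r v
          ... | inj₁ r≤v = begin
            v ⊔ r + s           ≃⟨ ℚ.+-congˡ s (ℚ.p≥q⇒p⊔q≃p r≤v) ⟩
            v + s               ≃⟨ ℚ.+-comm v s ⟩
            s + v               ≤⟨ +-mono-≤ (ℚ.p≤p⊔q s r) (ℚ.p≤p⊔q v s) ⟩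
            s ⊔ r + (v ⊔ s)     ≃⟨ ℚ.+-congˡ (v ⊔ s) (ℚ.⊔-congʳ r cap≃s) ⟨
            cap v ⊔ r + (v ⊔ s) ∎
          ... | inj₂ v≤r = begin
            v ⊔ r + s           ≃⟨ ℚ.+-congˡ s (ℚ.p≤q⇒p⊔q≃q v≤r) ⟩
            r + s               ≤⟨ +-mono-≤ (ℚ.p≤q⊔p s r) (ℚ.p≤q⊔p v s) ⟩
            s ⊔ r + (v ⊔ s)     ≃⟨ ℚ.+-congˡ (v ⊔ s) (ℚ.⊔-congʳ r cap≃s) ⟨
            cap v ⊔ r + (v ⊔ s) ∎

        -- For r ≤ s the previous inequality is an equality: a positive e forces cap v = s ≥ r.
        sum-above : ∀ {r} → r ≤ s → expect L (λ v → cap v ⊔ r) + expect L (_⊔ s) ≤ expect L (_⊔ r) + s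
        sum-above {r} r≤s = begin
          expect L (λ v → cap v ⊔ r) + expect L (_⊔ s) ≃⟨ expect-+ L (λ v → cap v ⊔ r) (_⊔ s) ⟨
          expect L (λ v → cap v ⊔ r + (v ⊔ s))  ≤⟨ expect-mono ps (All.map (λ {(v , _)} → pointwise v) caps) ⟩
          expect L (λ v → v ⊔ r + s)            ≃⟨ expect-shift {L} mass (_⊔ r) s ⟩
          expect L (_⊔ r) + s                   ∎
          where
          open ℚ.≤-Reasoning
          pointwise : ∀ v → (v ≤ s × cap v ≃ v) ⊎ (s < v × cap v ≃ s) → cap v ⊔ r + (v ⊔ s) ≤ v ⊔ r + s
          pointwise v (inj₁ (v≤s , cap≃v)) =
            ≤-reflexive (+-cong (ℚ.⊔-congʳ r cap≃v) (ℚ.p≤q⇒p⊔q≃q v≤s))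
          pointwise v (inj₂ (s<v , cap≃s)) = begin
            cap v ⊔ r + (v ⊔ s) ≃⟨ +-cong (≃-trans (ℚ.⊔-congʳ r cap≃s) (ℚ.p≥q⇒p⊔q≃p r≤s))
                                          (ℚ.p≥q⇒p⊔q≃p (ℚ.<⇒≤ s<v)) ⟩
            s + v               ≃⟨ ℚ.+-comm s v ⟩
            v + s               ≤⟨ ℚ.+-monoˡ-≤ s (ℚ.p≤p⊔q v r) ⟩
            v ⊔ r + s           ∎

        cap-above : ∀ {r} → s ≤ r → expect L (λ v → cap v ⊔ r) ≤ r
        cap-above {r} s≤r = ≤-trans
          (expect-mono ps (All.map (λ {(v , _)} → pointwise v) caps))
          (≤-reflexive (expect-const {L} mass r))
          where
          pointwise : ∀ v → (v ≤ s × cap v ≃ v) ⊎ (s < v × cap v ≃ s) → cap v ⊔ r ≤ r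
          pointwise v (inj₁ (v≤s , cap≃v)) =
            ≤-reflexive (≃-trans (ℚ.⊔-congʳ r cap≃v) (ℚ.p≤q⇒p⊔q≃q (≤-trans v≤s s≤r)))
          pointwise v (inj₂ (s<v , cap≃s)) =
            ≤-reflexive (≃-trans (ℚ.⊔-congʳ r cap≃s) (ℚ.p≤q⇒p⊔q≃q s≤r))

      opening≤capped : ∀ r → expect L (_⊔ r) - c ≤ expect L (λ v → cap v ⊔ r)
      opening≤capped r = +-cancelʳ-≤ (s + c) (begin
        expect L (_⊔ r) - c + (s + c)
          ≃⟨ solve 3 (λ e c s → e :- c :+ (s :+ c) := e :+ s) ≃-refl (expect L (_⊔ r)) c s ⟩
        expect L (_⊔ r) + s                              ≤⟨ sum-below r ⟩
        expect L (λ v → cap v ⊔ r) + expect L (_⊔ s)     ≤⟨ ℚ.+-monoʳ-≤ (expect L (λ v → cap v ⊔ r)) excess≤ ⟩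
        expect L (λ v → cap v ⊔ r) + (s + c)             ∎)
        where
        open ℚ.≤-Reasoning
        open ℚ-Solver.+-*-Solver

      -- The strict gain excludes s ≤ r, where the capped variable never exceeds r. From 0 ≤ r < s
      -- the alternative s = 0 is excluded as well, so the lower bound on the excess is available.
      capped≤opening : ∀ {r} → 0ℚᵘ ≤ r → r < expect L (λ v → cap v ⊔ r) →
                       expect L (λ v → cap v ⊔ r) ≤ expect L (_⊔ r) - c
      capped≤opening {r} 0≤r gain with s ℚ.≤? r
      ... | yes s≤r = contradiction (cap-above s≤r) (ℚ.<⇒≱ gain)
      ... | no  s≰r = +-cancelʳ-≤ (s + c) (begin
        expect L (λ v → cap v ⊔ r) + (s + c)             ≤⟨ ℚ.+-monoʳ-≤ (expect L (λ v → cap v ⊔ r)) excess ⟩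
        expect L (λ v → cap v ⊔ r) + expect L (_⊔ s)     ≤⟨ sum-above (ℚ.<⇒≤ r<s) ⟩
        expect L (_⊔ r) + s
          ≃⟨ solve 3 (λ e c s → e :- c :+ (s :+ c) := e :+ s) ≃-refl (expect L (_⊔ r)) c s ⟨
        expect L (_⊔ r) - c + (s + c)                    ∎)
        where
        r<s = ℚ.≰⇒> s≰r
        excess : s + c ≤ expect L (_⊔ s)
        excess with excess≥
        ... | inj₁ s≃0 = contradiction 0≤r (ℚ.<⇒≱ (ℚ.<-respʳ-≃ s≃0 r<s))
        ... | inj₂ s+c≤ = s+c≤
        open ℚ.≤-Reasoning
        open ℚ-Solver.+-*-Solver

  module _ (O : ProphetsOracle) where

    open Semantics {prophetsᵗ} {orderᵗ} O

    candidate : ⟦ boxᵗ ⟧ᵗ → ⟦ atomᵗ ⟧ᵗ → Frac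
    candidate (_ , c) AB = (proj₂ AB ⊖ c) ⊘ proj₁ AB

    improve : ⟦ boxᵗ ⟧ᵗ → ⟦ atomᵗ ⟧ᵗ → Frac → Frac
    improve box AB best = let q = candidate box AB in
      branch (proj₁ (proj₁ AB)) 0 best
        (branch (proj₁ best ℕ.* proj₂ q) (proj₁ q ℕ.* proj₂ best) q best)

    opaque
      unfolding threshold

      threshold-foldr : ∀ box → threshold O box ≡
        foldr (λ e → improve box (tails O (proj₁ e) (proj₁ box))) 0ᶠ (proj₁ box)
      threshold-foldr box = refl

    module _ {L : Law} (L≥0 : NonNegLaw L) (mass : Normalised L) {c : ℚᵘ} (0≤c : 0ℚᵘ ≤ c) where

      private
        box : ⟦ boxᵗ ⟧ᵗ
        box = encLaw′ L , encFrac c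

        Covers : ℚᵘ → Law → Set
        Covers s = All (λ (v , _) → part≥ L v ≤ c + s * mass≥ L v)

        Tight : ℚᵘ → Set
        Tight s = s ≃ 0ℚᵘ ⊎ ∃[ r ] part≥ L r ≃ c + s * mass≥ L r

        -- Loop invariant: `best` dominates the candidates of the values `M` scanned so far, with
        -- tails always taken in the whole of `L`, and it is zero or balances some tail exactly. The
        -- first property feeds `excess-upper`, the second `excess-lower`.
        record Good (M : Law) (best : Frac) : Set where
          field
            proper : Proper best
            covers : Covers (dec best) M
            tight  : Tight (dec best)

        cover-mono : ∀ {s t v} → s ≤ t → part≥ L v ≤ c + s * mass≥ L v → part≥ L v ≤ c + t * mass≥ L v
        cover-mono {v = v} s≤t cover = ≤-trans cover
          (ℚ.+-monoʳ-≤ c (*-monoˡ-≤ (0≤mass≥ L≥0 mass v) s≤t))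

        surplus≥0 : ∀ f v → 0ℚᵘ ≤ dec f * mass≥ L v
        surplus≥0 f v = ≤-trans (≤-reflexive (≃-sym (ℚ.*-zeroʳ (dec f))))
                                (*-monoʳ-≤ (0≤dec f) (0≤mass≥ L≥0 mass v))

        c≤cover : ∀ f v → c ≤ c + dec f * mass≥ L v
        c≤cover f v = ℚ.p≤p+q c (dec f * mass≥ L v) {{nonNegative (surplus≥0 f v)}}

        improve-good : ∀ {v p M AB best} → Represents O AB (mass≥ L v) (part≥ L v) →
                       Good M best → Good ((v , p) ∷ M) (improve box AB best)
        improve-good {v} {p} {M} {AB@(A , B)} {best} rep good =
          branch-elim O (Good ((v , p) ∷ M)) (proj₁ A) 0
            (λ A≤0 → record
              { proper = proper
              ; covers = ≤-trans (part≥≤0 L≥0 mass {v} (≤-trans (≤-reflexive (≃-sym mass≃))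
                                    (≤-reflexive (dec-zero {A} (ℕ.n≤0⇒n≡0 A≤0)))))
                                 (≤-trans 0≤c (c≤cover best v)) ∷ covers
              ; tight  = tight })
            (λ 0<A → let q✓ = ⊘-proper (B ⊖ encFrac c) A B⊖c✓ 0<A in
              ≼-elim O (Good ((v , p) ∷ M)) best q proper q✓
                (λ best≤q → record
                  { proper = q✓
                  ; covers = proj₁ (q-spec 0<A) ∷ All.map (λ {(w , _)} → cover-mono {v = w} best≤q) covers
                  ; tight  = proj₂ (q-spec 0<A) })
                (λ q<best → record
                  { proper = proper
                  ; covers = cover-mono {v = v} (ℚ.<⇒≤ q<best) (proj₁ (q-spec 0<A)) ∷ covers
                  ; tight  = tight }))
          where
          open Good good
          open Represents rep
          q = candidate box AB
          c✓ = encFrac-proper c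
          c≡ = dec-encFrac 0≤c
          B⊖c✓ = ⊖-proper B (encFrac c) part-proper c✓
          q-spec : 0 ℕ.< proj₁ A → part≥ L v ≤ c + dec q * mass≥ L v × Tight (dec q)
          q-spec 0<A with ℚ.≤-total (dec B) (dec (encFrac c))
          -- The numerator is truncated to 0, so the candidate is 0 and tightness takes its first
          -- form.
          ... | inj₁ B≤c =
            ≤-trans (≤-reflexive (≃-sym part≃)) (≤-trans (subst (dec B ≤_) c≡ B≤c) (c≤cover q v)) ,
            inj₁ (dec-zero {q} (cong (ℕ._* proj₂ A) (⊖-zero B (encFrac c) part-proper c✓ B≤c)))
          ... | inj₂ c≤B = ≤-reflexive balance , inj₂ (v , balance)
            where
            open ℚ.≤-Reasoning
            balance : part≥ L v ≃ c + dec q * mass≥ L v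
            balance = begin-equality
              part≥ L v                      ≃⟨ part≃ ⟨
              dec B                          ≃⟨ solve 2 (λ b c → b := c :+ (b :- c)) ≃-refl (dec B) c ⟩
              c + (dec B - c)                ≡⟨ cong (λ x → c + (dec B - x)) c≡ ⟨
              c + (dec B - dec (encFrac c))  ≡⟨ cong (c +_) (dec-⊖ B (encFrac c) part-proper c✓ c≤B) ⟨
              c + dec (B ⊖ encFrac c)        ≃⟨ ℚ.+-congʳ c (dec-⊘ (B ⊖ encFrac c) A B⊖c✓ mass-proper 0<A) ⟨
              c + dec q * dec A              ≃⟨ ℚ.+-congʳ c (ℚ.*-congˡ {dec q} mass≃) ⟩
              c + dec q * mass≥ L v          ∎
              where open ℚ-Solver.+-*-Solver

        fold-good : ∀ {M} → All (λ (v , _) → 0ℚᵘ ≤ v) M →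
          Good M (foldr (λ e → improve box (tails O (proj₁ e) (encLaw′ L))) 0ᶠ (encLaw′ M))
        fold-good [] = record { proper = _ ; covers = [] ; tight = inj₁ ≃-refl }
        fold-good {(v , p) ∷ M} (0≤v ∷ M≥0) = improve-good
          (subst (λ r → Represents O (tails O (encFrac v) (encLaw′ L)) (mass≥ L r) (part≥ L r))
            (dec-encFrac 0≤v) (tails-correct O {encFrac v} (encFrac-proper v) {L} L≥0))
          (fold-good M≥0)

        threshold-good : Good L (threshold O box)
        threshold-good = subst (Good L) (sym (threshold-foldr box)) (fold-good (proj₁ L≥0))

      threshold-proper : Proper (threshold O (encLaw′ L , encFrac c))
      threshold-proper = Good.proper threshold-good

      threshold-reservation : IsReservation L≥0 mass 0≤c (dec (threshold O (encLaw′ L , encFrac c)))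
      threshold-reservation = record
        { excess≤ = excess-upper L≥0 mass 0≤c (Good.covers threshold-good)
        ; excess≥ = tight⇒ (Good.tight threshold-good) }
        where
        tight⇒ : ∀ {s} → Tight s → s ≃ 0ℚᵘ ⊎ s + c ≤ expect L (_⊔ s)
        tight⇒ (inj₁ s≃0)     = inj₁ s≃0
        tight⇒ (inj₂ (r , t)) = inj₂ (excess-lower L≥0 mass 0≤c {r = r} t)

    min : Frac → Frac → Frac
    min f g = branch (proj₁ f ℕ.* proj₂ g) (proj₁ g ℕ.* proj₂ f) f g

    reservation : Box → Frac
    reservation b = threshold O (encLaw (content b) , encFrac (cost b))

    cap : Box → ℚᵘ → ℚᵘ
    cap b v = dec (min (encFrac v) (reservation b))

    law≥0 : ∀ X → NonNegLaw (law X)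
    law≥0 X = values≥0 X , probs≥0 X

    reservation-proper : ∀ b → Proper (reservation b)
    reservation-proper b = threshold-proper (law≥0 (content b)) (total-mass (content b)) (cost≥0 b)

    min-proper : ∀ f g → Proper f → Proper g → Proper (min f g)
    min-proper f g f✓ g✓ = branch-elim O Proper (proj₁ f ℕ.* proj₂ g) (proj₁ g ℕ.* proj₂ f) (λ _ → f✓) (λ _ → g✓)

    cap-law : Box → Law → Law
    cap-law b = map (λ (v , p) → cap b v , p)

    expect-cap : ∀ b L f → expect (cap-law b L) f ≡ expect L (λ v → f (cap b v))
    expect-cap b []            f = refl
    expect-cap b ((v , p) ∷ L) f = cong (p * f (cap b v) +_) (expect-cap b L f)

    -- The variable min(X, s⁺) shown to the prophet oracle.
    capped : Box → RV
    capped b = record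
      { law        = cap-law b (law (content b))
      ; values≥0   = values (law (content b))
      ; probs≥0    = probs (probs≥0 (content b))
      ; total-mass = ≃-trans (ℚ.≃-reflexive (expect-cap b (law (content b)) _)) (total-mass (content b))
      }
      where
      values : ∀ L → All (λ (v , _) → 0ℚᵘ ≤ v) (cap-law b L)
      values []            = []
      values ((v , _) ∷ L) = 0≤dec (min (encFrac v) (reservation b)) ∷ values L
      probs : ∀ {L} → Weighted L → Weighted (cap-law b L)
      probs []         = []
      probs (0≤p ∷ ps) = 0≤p ∷ probs ps

    cap-spec : ∀ b {v} → 0ℚᵘ ≤ v →
      (v ≤ dec (reservation b) × cap b v ≃ v) ⊎ (dec (reservation b) < v × cap b v ≃ dec (reservation b))
    cap-spec b {v} 0≤v = ≼-elim O
      (λ f → (v ≤ s × dec f ≃ v) ⊎ (s < v × dec f ≃ s))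
      (encFrac v) (reservation b) (encFrac-proper v) (reservation-proper b)
      (λ v≤s → inj₁ (subst (_≤ s) v≡ v≤s , ℚ.≃-reflexive v≡))
      (λ s<v → inj₂ (subst (s <_) v≡ s<v , ≃-refl))
      where
      s = dec (reservation b)
      v≡ = dec-encFrac 0≤v

    opening≤ : ∀ b r → 𝔼 (content b) (_⊔ r) - cost b ≤ 𝔼 (capped b) (_⊔ r)
    opening≤ b r = ≤-trans
      (opening≤capped (law≥0 (content b)) (total-mass (content b)) (cost≥0 b)
        (threshold-reservation (law≥0 (content b)) (total-mass (content b)) (cost≥0 b))
        (cap b) (cap-spec b) r)
      (ℚ.≤-reflexive-≡ (sym (expect-cap b (law (content b)) (_⊔ r))))

    ≤opening : ∀ b {r} → 0ℚᵘ ≤ r → r < 𝔼 (capped b) (_⊔ r) →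
               𝔼 (capped b) (_⊔ r) ≤ 𝔼 (content b) (_⊔ r) - cost b
    ≤opening b {r} 0≤r gain = ≤-trans (ℚ.≤-reflexive-≡ eq)
      (capped≤opening (law≥0 (content b)) (total-mass (content b)) (cost≥0 b)
        (threshold-reservation (law≥0 (content b)) (total-mass (content b)) (cost≥0 b))
        (cap b) (cap-spec b) 0≤r (subst (r <_) eq gain))
      where eq = expect-cap b (law (content b)) (_⊔ r)

    encLaw-capped : ∀ b L → encLaw′ (cap-law b L) ≡
      foldr (λ e es → (min (proj₁ e) (reservation b) , proj₂ e) ∷ es) [] (encLaw′ L)
    encLaw-capped b []            = refl
    encLaw-capped b ((v , p) ∷ L) = cong₂ _∷_
      (cong (_, encFrac p) (encFrac-dec (min-proper (encFrac v) (reservation b)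
                                          (encFrac-proper v) (reservation-proper b))))
      (encLaw-capped b L)

    opaque
      unfolding queryᵗ

      -- Literal equality is required, since the oracle's guarantee concerns encodings. The capped
      -- values are decoded from the program's own fractions, and `ℚᵘ` does not reduce, so encoding
      -- them returns the same pairs.
      query-correct : ∀ {n} (bs : Vec Box n) h →
        value queryᵗ (encPandora bs ∷ h ∷ []) ≡ encProphets (Vec.map capped bs)
      query-correct bs h = go bs
        where
        go : ∀ {m} (ds : Vec Box m) →
          foldr (λ box laws → value capᵗ (box ∷ laws ∷ encPandora bs ∷ h ∷ []) ∷ laws) [] (encPandora ds)
            ≡ encProphets (Vec.map capped ds)
        go []       = refl
        go (b ∷ ds) = cong₂ _∷_
          (trans (cap-value O (encLaw (content b) , encFrac (cost b)) _)
                 (sym (encLaw-capped b (law (content b)))))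
          (go ds)

-- Adaptive policies against orders of the capped variables

module Policies where

  open Fractions
  open Reservation
  open import Data.Fin.Permutation
    using (Permutation; permutation; _⟨$⟩ʳ_; _∘ₚ_; cast-id; ↔⇒≡)
  open import Data.Fin.Properties using (_≟_; cast-is-id)
  open import Data.Fin.Subset using (Subset; ⊤; _∈_; _∉_; _-_; ⁅_⁆)
  open import Data.Fin.Subset.Properties using (_∈?_; ∈⊤; p─q⊆p; x∈p∧x≢y⇒x∈p-y; drop-there)
  open import Data.List.Base using (filter; allFin)
  open import Data.List.Membership.Propositional using () renaming (_∈_ to _∈ˡ_)
  open import Data.List.Membership.Propositional.Properties using (∈-filter⁺; ∈-filter⁻; ∈-allFin; ∈-lookup)
  open import Data.List.Properties using (tabulate-lookup; map-tabulate; tabulate-cong)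
  open import Data.List.Relation.Unary.Any.Properties using (lookup-index)
  open import Data.List.Relation.Unary.Unique.Propositional using (Unique; []; _∷_)
  open import Data.List.Relation.Unary.Unique.Propositional.Properties using (filter⁺; allFin⁺)
  open import Data.Vec.Properties using (lookup-map; lookup∘update; lookup∘update′)

  𝔼-joint-cong : ∀ {n} (Xs : Vec RV n) {f g} → (∀ xs → f xs ≃ g xs) → 𝔼-joint Xs f ≃ 𝔼-joint Xs g
  𝔼-joint-cong []       f≃g = f≃g []
  𝔼-joint-cong (X ∷ Xs) f≃g = expect-cong (law X) (λ x → 𝔼-joint-cong Xs (λ xs → f≃g (x ∷ xs)))

  𝔼-joint-shift : ∀ {n} (Xs : Vec RV n) f k → 𝔼-joint Xs (λ xs → f xs + k) ≃ 𝔼-joint Xs f + k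
  𝔼-joint-shift []       f k = ≃-refl
  𝔼-joint-shift (X ∷ Xs) f k = ≃-trans
    (expect-cong (law X) (λ x → 𝔼-joint-shift Xs (λ xs → f (x ∷ xs)) k))
    (expect-shift {law X} (total-mass X) (λ x → 𝔼-joint Xs (λ xs → f (x ∷ xs))) k)

  𝔼-joint-const : ∀ {n} (Xs : Vec RV n) k → 𝔼-joint Xs (λ _ → k) ≃ k
  𝔼-joint-const []       k = ≃-refl
  𝔼-joint-const (X ∷ Xs) k = ≃-trans (expect-cong (law X) (λ _ → 𝔼-joint-const Xs k))
                                     (expect-const {law X} (total-mass X) k)

  -- Independence: the i-th variable may be drawn first.
  𝔼-joint-condition : ∀ {n} (Xs : Vec RV n) i f →
    𝔼-joint Xs f ≃ 𝔼 (lookup Xs i) (λ x → 𝔼-joint Xs (λ xs → f (xs [ i ]≔ x)))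
  𝔼-joint-condition (X ∷ Xs) zero    f = expect-cong (law X) λ x →
    ≃-sym (expect-const {law X} (total-mass X) (𝔼-joint Xs (λ xs → f (x ∷ xs))))
  𝔼-joint-condition (X ∷ Xs) (suc i) f = ≃-trans
    (expect-cong (law X) (λ y → 𝔼-joint-condition Xs i (λ xs → f (y ∷ xs))))
    (expect-swap (law X) (law (lookup Xs i)) (λ y x → 𝔼-joint Xs (λ xs → f (y ∷ (xs [ i ]≔ x)))))

  i∉S-i : ∀ {n} (S : Subset n) i → i ∉ S - i
  i∉S-i (_ ∷ S) zero    ()
  i∉S-i (_ ∷ S) (suc i) i∈ = i∉S-i S i (drop-there i∈)

  ∈-removed : ∀ {n} {S : Subset n} {i j} → j ∈ S - i → j ∈ S
  ∈-removed {S = S} {i} = p─q⊆p S ⁅ i ⁆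

  -- The value of the decision tree when each content is drawn only at its probe. This is the
  -- recursion that the optimality bound follows; `𝔼-utility` links it to the joint law.
  worth : ∀ {n} {S : Subset n} → Vec Box n → ℚᵘ → Policy S → ℚᵘ
  worth bs last stop          = last
  worth bs last (probe i _ π) =
    𝔼 (content (lookup bs i)) (λ x → worth bs x (π x)) ℚ.- cost (lookup bs i)

  utility-irrelevant : ∀ {n} {S : Subset n} last (bs : Vec Box n) xs (π : Policy S) {i} x → i ∉ S →
    utilityFrom last bs (xs [ i ]≔ x) π ≡ utilityFrom last bs xs π
  utility-irrelevant last bs xs stop x i∉S = refl
  utility-irrelevant last bs xs (probe j j∈S π) {i} x i∉S
    rewrite lookup∘update′ {i = j} {j = i} (λ { refl → i∉S j∈S }) xs x =
    cong (ℚ._- cost (lookup bs j))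
      (utility-irrelevant (lookup xs j) bs xs (π (lookup xs j)) x (λ i∈ → i∉S (∈-removed i∈)))

  -- Draw the probed box first, by `𝔼-joint-condition`. Its index has left the set of available
  -- boxes, so the continuation cannot read the overwritten coordinate and the induction hypothesis
  -- applies.
  𝔼-utility : ∀ {n} {S : Subset n} last (bs : Vec Box n) (π : Policy S) →
    𝔼-joint (Vec.map content bs) (λ xs → utilityFrom last bs xs π) ≃ worth bs last π
  𝔼-utility last bs stop = 𝔼-joint-const (Vec.map content bs) last
  𝔼-utility {S = S} last bs (probe i i∈S π) = begin
    𝔼-joint Xs f
      ≈⟨ 𝔼-joint-condition Xs i f ⟩
    𝔼 (lookup Xs i) (λ x → 𝔼-joint Xs (λ xs → f (xs [ i ]≔ x)))
      ≡⟨ cong (λ X → 𝔼 X (λ x → 𝔼-joint Xs (λ xs → f (xs [ i ]≔ x)))) (lookup-map i content bs) ⟩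
    𝔼 (content b) (λ x → 𝔼-joint Xs (λ xs → f (xs [ i ]≔ x)))
      ≈⟨ expect-cong (law (content b)) (λ x → ≃-trans
           (𝔼-joint-cong Xs (λ xs → ℚ.≃-reflexive (resample x xs)))
           (≃-trans (𝔼-joint-shift Xs (λ xs → utilityFrom x bs xs (π x)) (- cost b))
                    (ℚ.+-congˡ (- cost b) (𝔼-utility x bs (π x))))) ⟩
    𝔼 (content b) (λ x → worth bs x (π x) ℚ.- cost b)
      ≈⟨ expect-shift {law (content b)} (total-mass (content b)) (λ x → worth bs x (π x)) (- cost b) ⟩
    𝔼 (content b) (λ x → worth bs x (π x)) ℚ.- cost b ∎
    where
    open import Relation.Binary.Reasoning.Setoid ℚ.≃-setoid
    Xs = Vec.map content bs
    b = lookup bs i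
    f : Vec ℚᵘ _ → ℚᵘ
    f xs = utilityFrom last bs xs (probe i i∈S π)
    resample : ∀ x xs → f (xs [ i ]≔ x) ≡ utilityFrom x bs xs (π x) ℚ.- cost b
    resample x xs rewrite lookup∘update i xs x =
      cong (ℚ._- cost b) (utility-irrelevant x bs xs (π x) x (i∉S-i S i))

  R-∷ : ∀ X Xs → R Xs ≤ R (X ∷ Xs)
  R-∷ X Xs = ≤-trans (≤-reflexive (≃-sym (expect-const {law X} (total-mass X) (R Xs))))
    (expect-mono (probs≥0 X) (All.map (λ {(v , _)} _ → ℚ.p≤q⊔p v (R Xs)) (values≥0 X)))

  0≤R : ∀ Xs → 0ℚᵘ ≤ R Xs
  0≤R []       = ≤-refl
  0≤R (X ∷ Xs) = ≤-trans (0≤R Xs) (R-∷ X Xs)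

  -- Orders as lists

  record Enumerates {n} (l : List (Fin n)) (S : Subset n) : Set where
    field
      unique   : Unique l
      sound    : ∀ {i} → i ∈ˡ l → i ∈ S
      complete : ∀ {i} → i ∈ S → i ∈ˡ l

  enumeration : ∀ {n} (S : Subset n) → ∃[ l ] Enumerates l S
  enumeration {n} S = filter (_∈? S) (allFin n) , record
    { unique   = filter⁺ (_∈? S) (allFin⁺ n)
    ; sound    = λ i∈ → proj₂ (∈-filter⁻ (_∈? S) {xs = allFin n} i∈)
    ; complete = λ {i} i∈S → ∈-filter⁺ (_∈? S) (∈-allFin i) i∈S
    }

  enumerate-∷ : ∀ {n} {S : Subset n} {i l} → i ∈ S → Enumerates l (S - i) → Enumerates (i ∷ l) S
  enumerate-∷ {S = S} {i} {l} i∈S e = record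
    { unique   = All.tabulate (λ {j} j∈l i≡j → i∉S-i S i (subst (_∈ S - i) (sym i≡j) (sound j∈l))) ∷ unique
    ; sound    = λ { (here refl) → i∈S ; (there j∈l) → ∈-removed (sound j∈l) }
    ; complete = complete′
    }
    where
    open Enumerates e
    complete′ : ∀ {j} → j ∈ S → j ∈ˡ i ∷ l
    complete′ {j} j∈S with j ≟ i
    ... | yes j≡i = here j≡i
    ... | no  j≢i = there (complete (x∈p∧x≢y⇒x∈p-y j∈S j≢i))

  lookup-injective : ∀ {A : Set} {l : List A} → Unique l → ∀ s t → List.lookup l s ≡ List.lookup l t → s ≡ t
  lookup-injective (x∉ ∷ _) zero    zero    _  = refl
  lookup-injective {l = x ∷ l} (x∉ ∷ _) zero    (suc t) eq = contradiction eq (All.lookup x∉ (∈-lookup {xs = l} t))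
  lookup-injective {l = x ∷ l} (x∉ ∷ _) (suc s) zero    eq = contradiction (sym eq) (All.lookup x∉ (∈-lookup {xs = l} s))
  lookup-injective (_ ∷ u)  (suc s) (suc t) eq = cong suc (lookup-injective u s t eq)

  tabulate-cast : ∀ {A : Set} {m n} (m≡n : m ≡ n) (f : Fin n → A) →
                  List.tabulate (λ t → f (Fin.cast m≡n t)) ≡ List.tabulate f
  tabulate-cast refl f = tabulate-cong (λ t → cong f (cast-is-id refl t))

  -- Positions and indices are in bijection, and it is this bijection that shows the list to have
  -- length n; the positions are then cast to `Fin n`.
  enumeration⇒permutation : ∀ {n} {l : List (Fin n)} → Enumerates l ⊤ →
    ∃[ σ ] List.tabulate (λ t → σ ⟨$⟩ʳ t) ≡ l
  enumeration⇒permutation {n} {l} e = cast-id (sym (↔⇒≡ positions)) ∘ₚ positions ,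
    trans (tabulate-cast (sym (↔⇒≡ positions)) (List.lookup l)) (tabulate-lookup l)
    where
    open Enumerates e
    position : Fin n → Fin (length l)
    position i = Any.index (complete (∈⊤ {x = i}))
    lookup-position : ∀ i → List.lookup l (position i) ≡ i
    lookup-position i = sym (lookup-index (complete (∈⊤ {x = i})))
    positions : Permutation (length l) n
    positions = permutation (List.lookup l) position lookup-position
      (λ t → lookup-injective unique _ t (lookup-position (List.lookup l t)))

  module _ (O : ProphetsOracle) {n} (bs : Vec Box n) where

    private
      Ys : Vec RV n
      Ys = Vec.map (capped O) bs

    R-order : List (Fin n) → ℚᵘ
    R-order l = R (List.map (lookup Ys) l)

    R-order-∷ : ∀ i l → R-order (i ∷ l) ≡ 𝔼 (capped O (lookup bs i)) (_⊔ R-order l)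
    R-order-∷ i l = cong (λ Y → 𝔼 Y (_⊔ R-order l)) (lookup-map i (capped O) bs)

    V≡R-order : ∀ σ → V Ys σ ≡ R-order (List.tabulate (λ t → σ ⟨$⟩ʳ t))
    V≡R-order σ = cong R (sym (map-tabulate (λ t → σ ⟨$⟩ʳ t) (lookup Ys)))

    private
      -- Adaptivity is removed here. Different outcomes may lead to different orders of the
      -- remaining boxes, but each bound x ⊔ `R-order l` is monotone in `R-order l`, so the order of
      -- largest value serves all outcomes in the finite support.
      best : ∀ {S : Subset n} (f : ℚᵘ → ℚᵘ) →
        (∀ x → ∃[ l ] Enumerates l S × f x ≤ x ⊔ R-order l) → ∀ (L : Law) →
        ∃[ l ] Enumerates l S × All (λ (v , _) → f v ≤ v ⊔ R-order l) L
      best f bound [] = let l , e , _ = bound 0ℚᵘ in l , e , []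
      best f bound ((v , _) ∷ L) with bound v | best f bound L
      ... | l₁ , e₁ , v≤ | l₂ , e₂ , L≤ with ℚ.≤-total (R-order l₁) (R-order l₂)
      ...   | inj₁ l₁≤l₂ = l₂ , e₂ , ≤-trans v≤ (ℚ.⊔-monoʳ-≤ v l₁≤l₂) ∷ L≤
      ...   | inj₂ l₂≤l₁ = l₁ , e₁ , v≤ ∷ All.map (λ {(w , _)} w≤ → ≤-trans w≤ (ℚ.⊔-monoʳ-≤ w l₂≤l₁)) L≤

    -- The term `last` accounts for stopping at once. A probe forfeits it, so in that case it only
    -- enlarges the bound.
    worth≤ : ∀ {S : Subset n} last (π : Policy S) →
             ∃[ l ] Enumerates l S × worth bs last π ≤ last ⊔ R-order l
    worth≤ {S} last stop = let l , e = enumeration S in l , e , ℚ.p≤p⊔q last (R-order l)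
    worth≤ last (probe i i∈S π)
      with best (λ x → worth bs x (π x)) (λ x → worth≤ x (π x)) (law (content (lookup bs i)))
    ... | l , e , L≤ = i ∷ l , enumerate-∷ i∈S e , (begin
      𝔼 (content b) (λ x → worth bs x (π x)) ℚ.- cost b
        ≤⟨ ℚ.+-monoˡ-≤ (- cost b) (expect-mono (probs≥0 (content b)) L≤) ⟩
      𝔼 (content b) (_⊔ R-order l) ℚ.- cost b
        ≤⟨ opening≤ O b (R-order l) ⟩
      𝔼 (capped O b) (_⊔ R-order l)
        ≡⟨ R-order-∷ i l ⟨
      R-order (i ∷ l)
        ≤⟨ ℚ.p≤q⊔p last (R-order (i ∷ l)) ⟩
      last ⊔ R-order (i ∷ l) ∎)
      where
      open ℚ.≤-Reasoning
      b = lookup bs i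

    expectedUtility≤V : ∀ π → ∃[ σ ] expectedUtility bs π ≤ V Ys σ
    expectedUtility≤V π with worth≤ 0ℚᵘ π
    ... | l , e , π≤ with enumeration⇒permutation e
    ...   | σ , refl = σ , (begin
      expectedUtility bs π    ≃⟨ 𝔼-utility 0ℚᵘ bs π ⟩
      worth bs 0ℚᵘ π          ≤⟨ π≤ ⟩
      0ℚᵘ ⊔ R-order l         ≃⟨ ℚ.p≤q⇒p⊔q≃q (0≤R (List.map (lookup Ys) l)) ⟩
      R-order l               ≡⟨ V≡R-order σ ⟨
      V Ys σ                  ∎)
      where open ℚ.≤-Reasoning

-- Correctness of the scan along the order

module Decisions where

  open Fractions
  open Reservation
  open Policies
  open import Data.Fin.Properties using (toℕ-injective; toℕ<n)
  open import Data.List.Membership.Propositional.Properties using (∈-++⁺ʳ)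
  open import Data.List.Relation.Unary.Unique.Propositional using (Unique; []; _∷_)

  private
    dropS : ℕ × ⟦ prophetsᵗ ⟧ᵗ → ℕ × ⟦ prophetsᵗ ⟧ᵗ
    dropS (zero  , L)     = zero , L
    dropS (suc k , [])    = k , []
    dropS (suc k , _ ∷ L) = k , L

    head₀ : ⟦ prophetsᵗ ⟧ᵗ → ⟦ lawᵗ ⟧ᵗ
    head₀ []      = []
    head₀ (x ∷ _) = x

    -- `dropS` ignores the list elements, so the outermost application can be moved to the initial
    -- state. This turns the fold into an induction on the counter, and a state with counter 0 is
    -- fixed.
    dropS-foldr : ∀ {B : Set} k L (xs : List B) → k ℕ.≤ length xs →
                  foldr (λ _ → dropS) (k , L) xs ≡ (0 , drop k L)
    dropS-foldr zero L []       _ = refl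
    dropS-foldr zero L (x ∷ xs) _ = cong dropS (dropS-foldr zero L xs ℕ.z≤n)
    dropS-foldr {B} (suc k) L (x ∷ xs) (ℕ.s≤s k≤) =
      trans (commute (suc k , L) xs) (trans (cong (λ st → foldr (λ _ → dropS) st xs) (step L))
        (trans (dropS-foldr k (drop 1 L) xs k≤) (cong (0 ,_) (drop-drop L))))
      where
      commute : ∀ st (xs : List B) →
        dropS (foldr (λ _ → dropS) st xs) ≡ foldr (λ _ → dropS) (dropS st) xs
      commute st []       = refl
      commute st (x ∷ xs) = cong dropS (commute st xs)
      step : ∀ L → dropS (suc k , L) ≡ (k , drop 1 L)
      step []      = refl
      step (_ ∷ _) = refl
      drop-drop : ∀ L → drop k (drop 1 L) ≡ drop (suc k) L
      drop-drop []      = drop-[] k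
        where
        drop-[] : ∀ k → drop k [] ≡ []
        drop-[] zero    = refl
        drop-[] (suc k) = refl
      drop-drop (_ ∷ _) = refl

    head-drop : ∀ {n} (Ys : Vec RV n) i → head₀ (drop (toℕ i) (encProphets Ys)) ≡ encLaw (lookup Ys i)
    head-drop (Y ∷ Ys) zero    = refl
    head-drop (Y ∷ Ys) (suc i) = head-drop Ys i

    length-enc : ∀ {n} (Ys : Vec RV n) → length (encProphets Ys) ≡ n
    length-enc []       = refl
    length-enc (Y ∷ Ys) = cong suc (length-enc Ys)

  module _ (O : ProphetsOracle) where

    open Semantics {prophetsᵗ} {orderᵗ} O

    private
      drop-step-value : ∀ {Γ b} (x : ⟦ b ⟧ᵗ) (st : ⟦ nat ⊗ prophetsᵗ ⟧ᵗ) (ρ : Env Γ) →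
                        value (drop-step {a = lawᵗ} {b = b}) (x ∷ st ∷ ρ) ≡ dropS st
      drop-step-value x (zero  , L)     ρ = refl
      drop-step-value x (suc k , [])    ρ = refl
      drop-step-value x (suc k , _ ∷ L) ρ = refl

      head-value : ∀ {Γ} (s : T Γ prophetsᵗ) (ρ : Env Γ) →
                   value (caseList s nil #0) ρ ≡ head₀ (value s ρ)
      head-value s ρ with value s ρ
      ... | []    = refl
      ... | _ ∷ _ = refl

    opaque
      unfolding lookupᵗ

      lookup-value : ∀ {Γ n} (ρ : Env Γ) (Ys : Vec RV n) i (xsᵗ : T Γ prophetsᵗ) (iᵗ : T Γ nat) →
        value xsᵗ ρ ≡ encProphets Ys → value iᵗ ρ ≡ toℕ i →
        value (lookupᵗ xsᵗ iᵗ) ρ ≡ encLaw (lookup Ys i)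
      lookup-value ρ Ys i xsᵗ iᵗ xs≡ i≡ = begin
        value (lookupᵗ xsᵗ iᵗ) ρ
          ≡⟨ head-value (snd (fold xsᵗ (pair iᵗ xsᵗ) drop-step)) ρ ⟩
        head₀ (proj₂ (dropped (value xsᵗ ρ)))
          ≡⟨ cong (λ (st : ℕ × ⟦ prophetsᵗ ⟧ᵗ) → head₀ (proj₂ st)) (dropped≡ (value xsᵗ ρ)) ⟩
        head₀ (proj₂ (foldr (λ _ → dropS) (value iᵗ ρ , value xsᵗ ρ) (value xsᵗ ρ)))
          ≡⟨ cong₂ (λ k (xs : ⟦ prophetsᵗ ⟧ᵗ) → head₀ (proj₂ (foldr (λ _ → dropS) (k , xs) xs))) i≡ xs≡ ⟩
        head₀ (proj₂ (foldr (λ _ → dropS) (toℕ i , encProphets Ys) (encProphets Ys)))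
          ≡⟨ cong (λ (st : ℕ × ⟦ prophetsᵗ ⟧ᵗ) → head₀ (proj₂ st))
               (dropS-foldr (toℕ i) (encProphets Ys) (encProphets Ys)
                 (subst (toℕ i ℕ.≤_) (sym (length-enc Ys)) (ℕ.<⇒≤ (toℕ<n i)))) ⟩
        head₀ (drop (toℕ i) (encProphets Ys))
          ≡⟨ head-drop Ys i ⟩
        encLaw (lookup Ys i) ∎
        where
        open ≡-Reasoning
        dropped : ⟦ prophetsᵗ ⟧ᵗ → ℕ × ⟦ prophetsᵗ ⟧ᵗ
        dropped = foldr (λ x st → value drop-step (x ∷ st ∷ ρ)) (value iᵗ ρ , value xsᵗ ρ)
        dropped≡ : ∀ xs → dropped xs ≡ foldr (λ _ → dropS) (value iᵗ ρ , value xsᵗ ρ) xs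
        dropped≡ []       = refl
        dropped≡ (x ∷ xs) = trans (drop-step-value x (dropped xs) ρ) (cong dropS (dropped≡ xs))

  inputs : ⟦ pandoraᵗ ⟧ᵗ → ⟦ historyᵗ ⟧ᵗ → Env (pandoraᵗ ∷ historyᵗ ∷ [])
  inputs bs′ h = bs′ ∷ h ∷ []

  module _ (O : ProphetsOracle) {n} (bs : Vec Box n) where

    open Semantics {prophetsᵗ} {orderᵗ} O

    private
      Ys : Vec RV n
      Ys = Vec.map (capped O) bs

      query : ⟦ prophetsᵗ ⟧ᵗ
      query = encProphets Ys

      R* : List (Fin n) → ℚᵘ
      R* = R-order O bs

    -- The first box that strictly raises the continuation value. Strictness is what `≤opening`
    -- demands of a box before it is opened.
    next : List (Fin n) → ℕ
    next []       = n
    next (o ∷ os) with R* (o ∷ os) ℚ.≤? R* os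
    ... | yes _ = next os
    ... | no  _ = toℕ o

    next-skip : ∀ {o os} → R* (o ∷ os) ≤ R* os → next (o ∷ os) ≡ next os
    next-skip {o} {os} skip with R* (o ∷ os) ℚ.≤? R* os
    ... | yes _   = refl
    ... | no take = contradiction skip take

    next-take : ∀ {o os} → R* os < R* (o ∷ os) → next (o ∷ os) ≡ toℕ o
    next-take {o} {os} take with R* (o ∷ os) ℚ.≤? R* os
    ... | yes skip = contradiction skip (ℚ.<⇒≱ take)
    ... | no _     = refl

    Decides : ℚᵘ → List (Fin n) → ℕ → Set
    Decides x post a = (R* post ≤ x → a ≡ n) × (x < R* post → a ≡ next post)

    module _ (last : ⟦ nat ⊗ fracᵗ ⟧ᵗ) (order : ⟦ orderᵗ ⟧ᵗ) {Γ} (ρ′ : Env Γ) where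

      open Scan O last n order query ρ′

      private
        scan* : List (Fin n) → ⟦ stateᵗ ⟧ᵗ
        scan* os = scan (map toℕ os)

        -- The answer component is left to `scan-answer`, since it acquires its meaning only after
        -- the scan has reached the box probed last.
        record Correct (os : List (Fin n)) (st : ⟦ stateᵗ ⟧ᵗ) : Set where
          field
            R-proper : Proper (proj₁ st)
            R≃       : dec (proj₁ st) ≃ R* os
            next≡    : proj₁ (proj₂ st) ≡ next os

        tail-represents : ∀ o st → Proper (proj₁ st) → let L = law (lookup Ys o) ; r = dec (proj₁ st) in
                          Represents O (box-tail (toℕ o) st) (mass≥ L r) (part≥ L r)
        tail-represents o st R✓ = subst
          (λ l → Represents O (tails O (proj₁ st) l) (mass≥ L (dec (proj₁ st))) (part≥ L (dec (proj₁ st))))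
          (sym (lookup-value O (toℕ o ∷ st ∷ ρ) Ys o #5 #0 refl refl))
          (tails-correct O {proj₁ st} R✓ {L} (law≥0 O (lookup Ys o)))
          where L = law (lookup Ys o)

        -- At s = r the two tail inequalities meet: 𝔼[X; X ≥ r] + r = 𝔼[X ⊔ r] + P(X ≥ r) · r. As
        -- `∁ᶠ` truncates, it agrees with subtraction from 1 because the tail mass is at most 1.
        R-step : ∀ o os st AB → Correct os st →
          Represents O AB (mass≥ (law (lookup Ys o)) (dec (proj₁ st))) (part≥ (law (lookup Ys o)) (dec (proj₁ st))) →
          let R′ = proj₂ AB ⊕ ∁ᶠ (proj₁ AB) ⊛ proj₁ st in Proper R′ × dec R′ ≃ R* (o ∷ os)
        R-step o os (R , _) (A , B) correct rep = ⊕-proper B (∁ᶠ A ⊛ R) part-proper ∁AR✓ , (begin-equality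
          dec (B ⊕ ∁ᶠ A ⊛ R)
            ≡⟨ dec-⊕ B (∁ᶠ A ⊛ R) part-proper ∁AR✓ ⟩
          dec B + dec (∁ᶠ A ⊛ R)
            ≡⟨ cong (dec B +_) (dec-⊛ (∁ᶠ A) R ∁A✓ R-proper) ⟩
          dec B + dec (∁ᶠ A) * r
            ≡⟨ cong (λ x → dec B + x * r) (dec-∁ A mass-proper A≤1) ⟩
          dec B + (1ℚᵘ ℚ.- dec A) * r
            ≃⟨ solve 3 (λ a b r → b :+ (con 1ℚᵘ :- a) :* r := (b :+ r) :- a :* r) ≃-refl (dec A) (dec B) r ⟩
          dec B + r ℚ.- dec A * r
            ≃⟨ ℚ.+-cong (ℚ.+-congˡ r part≃) (ℚ.-‿cong (ℚ.*-congʳ {r} mass≃)) ⟩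
          part≥ L r + r ℚ.- mass≥ L r * r
            ≃⟨ ℚ.+-congˡ (- (mass≥ L r * r)) (ℚ.≤-antisym
                 (part≥-upper (law≥0 O Y) (total-mass Y) r r)
                 (part≥-lower (law≥0 O Y) (total-mass Y) r r
                   (All.map (λ _ → (λ r≤v → r≤v) , ℚ.<⇒≤) (values≥0 Y)))) ⟩
          expect L (_⊔ r) + mass≥ L r * r ℚ.- mass≥ L r * r
            ≃⟨ solve 2 (λ x y → x :+ y :- y := x) ≃-refl (expect L (_⊔ r)) (mass≥ L r * r) ⟩
          expect L (_⊔ r)
            ≃⟨ expect-cong L (λ v → ℚ.⊔-congˡ v R≃) ⟩
          R* (o ∷ os) ∎)
          where
          open Correct correct
          open Represents rep
          open ℚ.≤-Reasoning
          open ℚ-Solver.+-*-Solver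
          Y = lookup Ys o
          L = law Y
          r = dec R
          ∁A✓ = ∁-proper A mass-proper
          ∁AR✓ = ⊛-proper (∁ᶠ A) R ∁A✓ R-proper
          A≤1 : dec A ≤ 1ℚᵘ
          A≤1 = ≤-trans (≤-reflexive mass≃) (mass≥≤1 (law≥0 O Y) (total-mass Y) r)

        finish-correct : ∀ o os st R′ → Correct os st → Proper R′ → dec R′ ≃ R* (o ∷ os) →
                         Correct (o ∷ os) (finish R′ (toℕ o) st)
        finish-correct o os st@(R , (nx , _)) R′ correct R′✓ R′≃ = record
          { R-proper = R′✓
          ; R≃       = R′≃
          ; next≡    = ≼-elim O (_≡ next (o ∷ os)) R′ R R′✓ R-proper
              (λ R′≤R → trans next≡ (sym (next-skip {o} {os}
                (≤-trans (≤-reflexive (≃-sym R′≃)) (≤-trans R′≤R (≤-reflexive R≃))))))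
              (λ R<R′ → sym (next-take {o} {os} (ℚ.<-respʳ-≃ R′≃ (ℚ.<-respˡ-≃ R≃ R<R′))))
          }
          where open Correct correct

        scan-correct : ∀ os → Correct os (scan* os)
        scan-correct []       = record { R-proper = _ ; R≃ = ≃-refl ; next≡ = refl }
        scan-correct (o ∷ os) = subst (Correct (o ∷ os)) (sym (scan-∷ (toℕ o) (map toℕ os)))
          (let ih = scan-correct os
               R′✓ , R′≃ = R-step o os st (box-tail (toℕ o) st) ih
                             (tail-represents o st (Correct.R-proper ih))
           in finish-correct o os st _ ih R′✓ R′≃)
          where st = scan* os

      scan-next : ∀ os → proj₁ (proj₂ (scan* os)) ≡ next os
      scan-next os = Correct.next≡ (scan-correct os)

      -- The scan runs from the end, so at `o` the state describes exactly `post`. The boxes of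
      -- `pre` come afterwards and leave the answer alone, as the order has no duplicates.
      scan-answer : ∀ {o x} → 0ℚᵘ ≤ x → last ≡ (toℕ o , encFrac x) → ∀ pre {post} →
        Unique (pre ++ o ∷ post) → Decides x post (proj₂ (proj₂ (scan* (pre ++ o ∷ post))))
      scan-answer {o} {x} 0≤x refl [] {post} _ =
        subst (λ st → Decides x post (proj₂ (proj₂ st))) (sym (scan-∷ (toℕ o) (map toℕ post)))
          (branch-elim O (Decides x post) (toℕ o) (toℕ o)
            (λ _ → branch-elim O (Decides x post) (toℕ o) (toℕ o)
              (λ _ → ≼-elim O (Decides x post) (proj₁ st) (encFrac x) R-proper (encFrac-proper x)
                (λ R≤x → (λ _ → refl) , λ x<R → contradiction
                  (≤-trans (≤-reflexive (≃-sym R≃)) (subst (dec (proj₁ st) ≤_) (dec-encFrac 0≤x) R≤x))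
                  (ℚ.<⇒≱ x<R))
                (λ x<R → (λ R≤x → contradiction R≤x (ℚ.<⇒≱
                  (ℚ.<-respʳ-≃ R≃ (subst (_< dec (proj₁ st)) (dec-encFrac 0≤x) x<R)))) , (λ _ → next≡)))
              (λ o<o → contradiction o<o (ℕ.<-irrefl refl)))
            (λ o<o → contradiction o<o (ℕ.<-irrefl refl)))
        where
        st = scan* post
        open Correct (scan-correct post)
      scan-answer {o} {x} 0≤x refl (p ∷ pre) {post} (p∉ ∷ u) =
        subst (λ st → Decides x post (proj₂ (proj₂ st))) (sym (scan-∷ (toℕ p) (map toℕ (pre ++ o ∷ post))))
          (branch-elim O (Decides x post) (toℕ p) (toℕ o)
            (λ p≤o → branch-elim O (Decides x post) (toℕ o) (toℕ p)
              (λ o≤p → contradiction (toℕ-injective (ℕ.≤-antisym p≤o o≤p)) (All.lookup p∉ (∈-++⁺ʳ pre (here refl))))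
              (λ _ → ih))
            (λ _ → ih))
        where ih = scan-answer {o} {x} 0≤x refl pre u

    private
      count : ⟦ prophetsᵗ ⟧ᵗ → ℕ
      count = foldr (λ _ → suc) 0

      count≡n : ∀ {m} (Xs : Vec RV m) → count (encProphets Xs) ≡ m
      count≡n []       = refl
      count≡n (X ∷ Xs) = cong suc (count≡n Xs)

    opaque
      unfolding decisionᵗ

      private
        decision-[]′ : ∀ order bs′ → value decisionᵗ (order ∷ query ∷ inputs bs′ []) ≡
          proj₁ (proj₂ (Scan.scan O (count query , 0ᶠ) (count query) order query (inputs bs′ []) order))
        decision-[]′ order bs′ = refl

        decision-∷′ : ∀ order bs′ e h → value decisionᵗ (order ∷ query ∷ inputs bs′ (e ∷ h)) ≡
          proj₂ (proj₂ (Scan.scan O e (count query) order query (inputs bs′ (e ∷ h)) order))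
        decision-∷′ order bs′ e h = refl

    decision-[] : ∀ os bs′ → value decisionᵗ (map toℕ os ∷ query ∷ inputs bs′ []) ≡ next os
    decision-[] os bs′ = trans (decision-[]′ (map toℕ os) bs′)
      (trans (cong (λ k → proj₁ (proj₂ (Scan.scan O (k , 0ᶠ) k (map toℕ os) query (inputs bs′ []) (map toℕ os))))
                (count≡n Ys))
             (scan-next (n , 0ᶠ) (map toℕ os) (inputs bs′ []) os))

    decision-∷ : ∀ {o x} → 0ℚᵘ ≤ x → ∀ pre {post} → Unique (pre ++ o ∷ post) → ∀ bs′ h →
      Decides x post
        (value decisionᵗ (map toℕ (pre ++ o ∷ post) ∷ query ∷ inputs bs′ ((toℕ o , encFrac x) ∷ h)))
    decision-∷ {o} {x} 0≤x pre {post} u bs′ h = subst (Decides x post)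
      (sym (trans (decision-∷′ order bs′ e h)
        (cong (λ k → proj₂ (proj₂ (Scan.scan O e k order query (inputs bs′ (e ∷ h)) order))) (count≡n Ys))))
      (scan-answer e order (inputs bs′ (e ∷ h)) 0≤x refl pre u)
      where
      order = map toℕ (pre ++ o ∷ post)
      e = toℕ o , encFrac x

-- Value of the policy followed, and the final bounds

module Approximation where

  open Fractions
  open Reservation
  open Policies
  open Decisions
  open import Data.Fin.Permutation as Perm using (Permutation′; _⟨$⟩ʳ_)
  open import Data.Fin.Properties using (toℕ-injective; toℕ-fromℕ<; toℕ<n)
  open import Data.Fin.Subset using (Subset; _∈_; _-_)
  open import Data.Fin.Subset.Properties using (_∈?_; ∈⊤; x∈p∧x≢y⇒x∈p-y)
  open import Data.List.Membership.Propositional using () renaming (_∈_ to _∈ˡ_)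
  open import Data.List.Properties using (map-tabulate; length-tabulate; ++-assoc)
  open import Data.List.Relation.Unary.Unique.Propositional using (Unique; []; _∷_)
  open import Data.List.Relation.Unary.Unique.Propositional.Properties using (tabulate⁺)

  follow-stop : ∀ {n} m rule (S : Subset n) h → rule h ≡ n → follow m rule S h ≡ stop
  follow-stop zero rule S h eq = refl
  follow-stop {n} (suc m) rule S h eq with rule h ℕ.<? n
  ... | no  _  = refl
  ... | yes k< = contradiction k< (ℕ.<-irrefl eq)

  -- The membership proof is existential because `follow` carries the one produced by its own test.
  follow-probe : ∀ {n} m rule {S : Subset n} h {i} → rule h ≡ toℕ i → i ∈ S →
    ∃[ i∈S ] follow (suc m) rule S h ≡ probe i i∈S (λ x → follow m rule (S - i) ((i , x) ∷ h))
  follow-probe {n} m rule {S} h {i} eq i∈S =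
    subst (λ j → ∃[ j∈S ] follow (suc m) rule S h ≡ probe j j∈S (λ x → follow m rule (S - j) ((j , x) ∷ h)))
      j≡i (probe-j (subst (_∈ S) (sym j≡i) i∈S))
    where
    k<n : rule h ℕ.< n
    k<n = subst (ℕ._< n) (sym eq) (toℕ<n i)
    j : Fin n
    j = fromℕ< k<n
    j≡i : j ≡ i
    j≡i = toℕ-injective (trans (toℕ-fromℕ< k<n) eq)
    probe-j : j ∈ S →
      ∃[ j∈S ] follow (suc m) rule S h ≡ probe j j∈S (λ x → follow m rule (S - j) ((j , x) ∷ h))
    probe-j j∈S with rule h ℕ.<? n
    ... | no  k≮n = contradiction k<n k≮n
    ... | yes k<n with fromℕ< k<n ∈? S
    ...   | yes j∈S′ = j∈S′ , refl
    ...   | no  j∉S  = contradiction j∈S j∉S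

  module _ (O : ProphetsOracle) {n} (bs : Vec Box n) (rule : History n → ℕ) (order : List (Fin n))
           (unique : Unique order)
           (answers : ∀ {o x} → 0ℚᵘ ≤ x → ∀ pre {post} → order ≡ pre ++ o ∷ post →
                      ∀ h → Decides O bs x post (rule ((o , x) ∷ h)))
    where

    private
      R* : List (Fin n) → ℚᵘ
      R* = R-order O bs

      later : ∀ pre {o : Fin n} {post} → Unique (pre ++ o ∷ post) → ∀ {i} → i ∈ˡ post → i ≢ o
      later []        (o∉ ∷ _) i∈ i≡o = All.lookup o∉ i∈ (sym i≡o)
      later (_ ∷ pre) (_ ∷ u)  i∈     = later pre u i∈

    -- Opening a box with strict gain is worth its capped value. Afterwards the rule stops with x or
    -- continues with at least `R* post`, whichever is larger, which gives x ⊔ `R* post`. When the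
    -- order is exhausted, `last` ≥ 0 meets the empty value 0.
    follow-worth : ∀ rest pre → order ≡ pre ++ rest → ∀ m {S} h {last} → length rest ℕ.≤ m →
      (∀ {i} → i ∈ˡ rest → i ∈ S) → rule h ≡ next O bs rest → 0ℚᵘ ≤ last →
      R* rest ≤ worth bs last (follow m rule S h)
    follow-worth [] pre eq m {S} h {last} _ _ rule≡ 0≤last =
      subst (λ π → 0ℚᵘ ≤ worth bs last π) (sym (follow-stop m rule S h rule≡)) 0≤last
    follow-worth (o ∷ post) pre eq (suc m) {S} h {last} (ℕ.s≤s len≤) rest⊆S rule≡ 0≤last
      with R* (o ∷ post) ℚ.≤? R* post
    -- A skipped box uses up no probe: history, available boxes and fuel stay, and only the split of
    -- the order moves.
    ... | yes skip = ≤-trans skip (follow-worth post (pre ++ o ∷ []) (trans eq (sym (++-assoc pre (o ∷ []) post)))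
            (suc m) h (ℕ.m≤n⇒m≤1+n len≤) (λ i∈ → rest⊆S (there i∈))
            rule≡ 0≤last)
    ... | no ¬skip with follow-probe m rule {S} h rule≡ (rest⊆S (here refl))
    ...   | o∈S , follow≡ = begin
      R* (o ∷ post)
        ≡⟨ R-order-∷ O bs o post ⟩
      𝔼 (capped O b) (_⊔ R* post)
        ≤⟨ ≤opening O b (0≤R (map (lookup (Vec.map (capped O) bs)) post)) gain ⟩
      𝔼 (content b) (_⊔ R* post) ℚ.- cost b
        ≤⟨ ℚ.+-monoˡ-≤ (- cost b) (expect-mono (probs≥0 (content b))
             (All.map (λ {(x , _)} 0≤x → continue x 0≤x) (values≥0 (content b)))) ⟩
      𝔼 (content b) (λ x → worth bs x (follow m rule (S - o) ((o , x) ∷ h))) ℚ.- cost b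
        ≡⟨ cong (worth bs last) follow≡ ⟨
      worth bs last (follow (suc m) rule S h) ∎
      where
      open ℚ.≤-Reasoning
      b = lookup bs o
      gain : R* post < 𝔼 (capped O b) (_⊔ R* post)
      gain = subst (R* post <_) (R-order-∷ O bs o post) (ℚ.≰⇒> ¬skip)
      continue : ∀ x → 0ℚᵘ ≤ x → x ⊔ R* post ≤ worth bs x (follow m rule (S - o) ((o , x) ∷ h))
      continue x 0≤x with R* post ℚ.≤? x
      ... | yes R≤x = subst (λ π → x ⊔ R* post ≤ worth bs x π)
        (sym (follow-stop m rule (S - o) ((o , x) ∷ h) (proj₁ (answers 0≤x pre eq h) R≤x)))
        (≤-reflexive (ℚ.p≥q⇒p⊔q≃p R≤x))
      ... | no  R≰x = ≤-trans (≤-reflexive (ℚ.p≤q⇒p⊔q≃q (ℚ.<⇒≤ (ℚ.≰⇒> R≰x))))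
        (follow-worth post (pre ++ o ∷ []) (trans eq (sym (++-assoc pre (o ∷ []) post)))
          m ((o , x) ∷ h) len≤
          (λ i∈ → x∈p∧x≢y⇒x∈p-y (rest⊆S (there i∈)) (later pre (subst Unique eq unique) i∈))
          (proj₂ (answers 0≤x pre eq h) (ℚ.≰⇒> R≰x)) 0≤x)

  module _ {α : ℚᵘ} (0<α : 0ℚᵘ < α) (O : ProphetsOracle) (approximation : IsProphetsApproximation α O) where

    open Semantics {prophetsᵗ} {orderᵗ} O

    module _ {n} (bs : Vec Box n) where

      private
        Ys : Vec RV n
        Ys = Vec.map (capped O) bs

        σ : Permutation′ n
        σ = proj₁ (approximation Ys)

        order : List (Fin n)
        order = List.tabulate (λ t → σ ⟨$⟩ʳ t)

        answer≡ : O (encProphets Ys) ≡ map toℕ order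
        answer≡ = trans (proj₁ (proj₂ (approximation Ys))) (sym (map-tabulate (λ t → σ ⟨$⟩ʳ t) toℕ))

        order-unique : Unique order
        order-unique = tabulate⁺ (λ {s} {t} eq → trans (sym (Perm.inverseˡ σ))
          (trans (cong (σ Perm.⟨$⟩ˡ_) eq) (Perm.inverseˡ σ)))

        rule : History n → ℕ
        rule = decide O program bs

        rule≡ : ∀ h → rule h ≡ value decisionᵗ (map toℕ order ∷ encProphets Ys ∷
                                                inputs (encPandora bs) (encHistory h))
        rule≡ h = cong₂ (λ q os → value decisionᵗ (os ∷ q ∷ inputs (encPandora bs) (encHistory h)))
          (query-correct O bs (encHistory h))
          (trans (cong O (query-correct O bs (encHistory h))) answer≡)

      rule-worth : V Ys σ ≤ expectedUtility bs (policyOf rule)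
      rule-worth = begin
        V Ys σ                            ≡⟨ V≡R-order O bs σ ⟩
        R-order O bs order
          ≤⟨ follow-worth O bs rule order order-unique answers order [] refl n []
               (ℕ.≤-reflexive (length-tabulate (λ t → σ ⟨$⟩ʳ t))) (λ _ → ∈⊤)
               (trans (rule≡ []) (decision-[] O bs order (encPandora bs))) ≤-refl ⟩
        worth bs 0ℚᵘ (policyOf rule)      ≃⟨ 𝔼-utility 0ℚᵘ bs (policyOf rule) ⟨
        expectedUtility bs (policyOf rule) ∎
        where
        open ℚ.≤-Reasoning
        answers : ∀ {o x} → 0ℚᵘ ≤ x → ∀ pre {post} → order ≡ pre ++ o ∷ post →
                  ∀ h → Decides O bs x post (rule ((o , x) ∷ h))
        answers {o} {x} 0≤x pre {post} eq h = subst (Decides O bs x post) (sym (trans (rule≡ ((o , x) ∷ h))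
            (cong (λ os → value decisionᵗ (map toℕ os ∷ encProphets Ys ∷
                     inputs (encPandora bs) (encHistory ((o , x) ∷ h)))) eq)))
          (decision-∷ O bs 0≤x pre (subst Unique eq order-unique) (encPandora bs) (encHistory h))

      program-approximates : policyOf (decide O program bs) ApproximatesPandora α On bs
      program-approximates π with expectedUtility≤V O bs π
      ... | σ′ , π≤ = begin
        α * expectedUtility bs π            ≤⟨ *-monoʳ-≤ (ℚ.<⇒≤ 0<α) π≤ ⟩
        α * V Ys σ′                         ≤⟨ proj₂ (proj₂ (approximation Ys)) σ′ ⟩
        V Ys σ                              ≤⟨ rule-worth ⟩
        expectedUtility bs (policyOf rule)  ∎
        where open ℚ.≤-Reasoning

      answer-size : ∀ (h : History n) → let ρ = inputs (encPandora bs) (encHistory h) in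
        size orderᵗ (O (value queryᵗ ρ)) ℕ.≤ eval order-size ∥ ρ ∥
      answer-size h = ℕ.≤-trans (ℕ.≤-reflexive (cong (size orderᵗ)
          (trans (cong O (query-correct O bs (encHistory h))) answer≡)))
        (ℕ.≤-trans (list≤ order)
          (ℕ.s≤s (ℕ.≤-trans (ℕ.*-monoˡ-≤ (2 ℕ.+ n) (ℕ.≤-reflexive (length-tabulate (λ t → σ ⟨$⟩ʳ t))))
            (ℕ.*-mono-≤ n≤ (ℕ.+-monoʳ-≤ 2 n≤)))))
        where
        N = ∥ inputs (encPandora bs) (encHistory h) ∥
        list≤ : ∀ (os : List (Fin n)) → size orderᵗ (map toℕ os) ℕ.≤ suc (length os ℕ.* (2 ℕ.+ n))
        list≤ []       = ℕ.s≤s ℕ.z≤n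
        list≤ (o ∷ os) = ℕ.s≤s (ℕ.≤-trans
          (ℕ.+-mono-≤ (size≤ (ℕ.<-≤-trans (n<2^n (toℕ o)) (ℕ.^-monoʳ-≤ 2 (ℕ.<⇒≤ (toℕ<n o))))) (list≤ os))
          (ℕ.≤-reflexive (ℕ.+-suc (suc n) _)))
        length-enc : ∀ {m} (ds : Vec Box m) → length (encPandora ds) ≡ m
        length-enc []       = refl
        length-enc (d ∷ ds) = cong suc (length-enc ds)
        n≤ : n ℕ.≤ N
        n≤ = ℕ.≤-trans (ℕ.≤-reflexive (sym (length-enc bs)))
          (ℕ.≤-trans (length≤size boxᵗ (encPandora bs)) (ℕ.m≤m+n _ _))

    -- The factor `2 ^ d` absorbs a successor: `∥ ρ ∥` is the input length N, and N ≥ 1 gives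
    -- `suc ∥ ρ ∥` ≤ 2N.
    program-polytime : ∀ c d → (∀ ρ → size orderᵗ (O (value queryᵗ ρ)) ℕ.≤ eval order-size ∥ ρ ∥ →
                         time program ρ ℕ.≤ c ℕ.* suc ∥ ρ ∥ ℕ.^ d) →
                       RunsInTime (c ℕ.* 2 ℕ.^ d) d O program
    program-polytime c d time≤ bs h = begin
      time program ρ                      ≤⟨ time≤ ρ (answer-size bs h) ⟩
      c ℕ.* suc ∥ ρ ∥ ℕ.^ d               ≤⟨ ℕ.*-monoʳ-≤ c (ℕ.^-monoˡ-≤ d suc≤) ⟩
      c ℕ.* (2 ℕ.* N) ℕ.^ d               ≡⟨ cong (c ℕ.*_) (^-distribʳ-* d 2 N) ⟩
      c ℕ.* (2 ℕ.^ d ℕ.* N ℕ.^ d)         ≡⟨ ℕ.*-assoc c (2 ℕ.^ d) (N ℕ.^ d) ⟨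
      c ℕ.* 2 ℕ.^ d ℕ.* N ℕ.^ d           ∎
      where
      open ℕ.≤-Reasoning
      ρ = inputs (encPandora bs) (encHistory h)
      N = size pandoraᵗ (encPandora bs) ℕ.+ size historyᵗ (encHistory h)
      suc≤ : suc ∥ ρ ∥ ℕ.≤ 2 ℕ.* N
      suc≤ = ℕ.≤-trans
        (ℕ.≤-reflexive (cong (λ k → suc (size pandoraᵗ (encPandora bs) ℕ.+ k)) (ℕ.+-identityʳ _)))
        (ℕ.≤-trans (ℕ.+-monoˡ-≤ N (ℕ.≤-trans (1≤size pandoraᵗ (encPandora bs)) (ℕ.m≤m+n _ _)))
                   (ℕ.≤-reflexive (cong (N ℕ.+_) (sym (ℕ.+-identityʳ N)))))

open Approximation

theorem6p1 : ∃[ P ] ∃[ c ] ∃[ d ]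
    ((α : ℚᵘ) → 0ℚᵘ < α → α ≤ 1ℚᵘ →
    (O : ProphetsOracle) → IsProphetsApproximation α O →
    RunsInTime c d O P × IsPandoraApproximation α O P)
theorem6p1 with program-time
... | p , time≤ with eval≤monomial p
...   | c , d , p≤ = program , c ℕ.* 2 ℕ.^ d , d , λ α 0<α _ O approximation →
  program-polytime 0<α O approximation c d (λ ρ answer≤ → ℕ.≤-trans (time≤ O ρ answer≤) (p≤ ∥ ρ ∥)) ,
  program-approximates 0<α O approximation
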